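{- Let $n\ge 4$, let $D=D(H_n)$ be the distance matrix of the helm graph $H_n$ (of order $2n-1$), and let $S=\mathrm{Circ}(\mathbf{s}')$ with $\mathbf{s}=(2,1,0,\dots,0,1)'\in\mathbb{R}^{n-1}$. For a real matrix $L$ of order $2n-1$, the following are equivalent: (a) $L$ is Laplacian-like and there exist a non-zero $\alpha\in\mathbb{R}$ and $\mathbf{w}\in\mathbb{R}^{2n-1}$ with $\mathbf{e}'\mathbf{w}=1$ such that $D^{\dagger}=-\frac12L+\alpha\,\mathbf{w}\mathbf{w}'$. (b) $$L=\begin{bmatrix}\frac{n-1}{2}&-\frac12\mathbf{e}'&\mathbf{0}'\\ -\frac12\mathbf{e}&A&B\\ \mathbf{0}&B'&I_{n-1}\end{bmatrix}$$ for some real symmetric matrices $A$ and $B$ of order $n-1$ satisfying: (i) $A\mathbf{e}=\frac32\mathbf{e}$; (ii) $B\mathbf{e}=-\mathbf{e}$; (iii) $BS=-S$; (iv) $(B+I)A=O$; (v) $(B+I)B=O$; (vi) $(A+B)S+2B=O$.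
   Context: A prime denotes transpose; $\mathbf{e}$ and $\mathbf{0}$ are the all-ones and zero column vectors of the appropriate dimension, $J_{n-1}$ is the all-ones matrix and $I=I_{n-1}$ the identity of order $n-1$, $O$ a zero matrix. A real matrix is Laplacian-like if it is symmetric and all its row sums are zero. For $\mathbf{a}=(a_1,\dots,a_N)'\in\mathbb{R}^N$, $\mathrm{Circ}(\mathbf{a}')$ is the $N\times N$ circulant matrix with first row $(a_1,a_2,\dots,a_N)$, each subsequent row being the previous row cyclically shifted one place to the right. Helm graph: for $n\ge4$, the wheel $W_n$ consists of a cycle on $v_1,\dots,v_{n-1}$ together with a vertex $v_0$ adjacent to all $v_i$; the helm graph $H_n$ (on $2n-1$ vertices) is obtained from $W_n$ by attaching to each $v_i$, $1\le i\le n-1$, a pendant vertex $u_i$. The distance matrix $D(H_n)$ has as entries the shortest-path distances, with vertices ordered $v_0,v_1,\dots,v_{n-1},u_1,\dots,u_{n-1}$. Explicitly, $$D(H_n)=\begin{bmatrix}0&\mathbf{e}'&2\mathbf{e}'\\ \mathbf{e}&2J_{n-1}-S&3J_{n-1}-S\\ 2\mathbf{e}&3J_{n-1}-S&4J_{n-1}-S-2I_{n-1}\end{bmatrix}.$$ The Moore-Penrose inverse $M^\dagger$ of a real matrix $M$ is the unique $X$ with $MXM=M$, $XMX=X$, $(MX)'=MX$, $(XM)'=XM$. -}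

module Defs where

open import Algebra.Bundles using (CommutativeRing)
import Algebra.Properties.CommutativeMonoid.Sum as CommutativeMonoidSum
open import Data.Bool.Base using (if_then_else_; _∨_)
open import Data.Fin.Base using (Fin; toℕ)
import Data.Fin.Properties as Fin
open import Data.Integer.Base using (+_)
open import Data.Nat.Base as ℕ using (ℕ; zero; suc)
open import Data.Nat.GeneralisedArithmetic using (fold)
import Data.Nat.Properties as ℕ
open import Data.Product.Base using (∃-syntax; _×_; _,_)
open import Data.Rational.Base as ℚ using (ℚ; 0ℚ; 1ℚ; ½; ∣_∣)
import Data.Rational.Properties as ℚ
open import Data.Rational.Solver using (module +-*-Solver)
open import Data.Vec.Functional using (Vector; _∷_; _++_; init; last; replicate; zipWith; transpose)
open import Level using (0ℓ)
open import Relation.Binary.Construct.Closure.Symmetric using (SymClosure)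
open import Relation.Binary.Core using (Rel)
open import Relation.Binary.PropositionalEquality.Core using (_≡_; refl; sym; trans; cong; subst)
open import Relation.Nullary.Decidable.Core using (does)

infix 4 _~_ _≃_

-- Two independent indices: on Cauchy sequences this says that the difference
-- tends to zero, and the diagonal x ~ x is the Cauchy condition itself.
record _~_ (x y : ℕ → ℚ) : Set where
  no-eta-equality
  field
    modulus : ∀ ε → 0ℚ ℚ.< ε →
      ∃[ N ] (∀ m n → N ℕ.≤ m → N ℕ.≤ n → ∣ x m ℚ.- y n ∣ ℚ.< ε)

open _~_ public

record ℝ : Set where
  no-eta-equality
  field
    seq    : ℕ → ℚ
    cauchy : seq ~ seq

open ℝ public

record _≃_ (x y : ℝ) : Set where
  no-eta-equality
  constructor mk≃
  field
    seq~ : seq x ~ seq y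

open _≃_ public

private
  open +-*-Solver using (solve; con; _:=_; _:+_; _:*_; :-_; _:-_)

  ≤ˡ : ∀ {o} m n → m ℕ.⊔ n ℕ.≤ o → m ℕ.≤ o
  ≤ˡ = ℕ.m⊔n≤o⇒m≤o

  ≤ʳ : ∀ {o} m n → m ℕ.⊔ n ℕ.≤ o → n ℕ.≤ o
  ≤ʳ = ℕ.m⊔n≤o⇒n≤o

  ½ε>0 : ∀ {ε} → 0ℚ ℚ.< ε → 0ℚ ℚ.< ½ ℚ.* ε
  ½ε>0 {ε} 0<ε = subst (ℚ._< ½ ℚ.* ε) (ℚ.*-zeroʳ ½) (ℚ.*-monoʳ-<-pos ½ 0<ε)

  ½ε+½ε : ∀ ε → ½ ℚ.* ε ℚ.+ ½ ℚ.* ε ≡ ε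
  ½ε+½ε = solve 1 (λ e → con ½ :* e :+ con ½ :* e := e) refl

  -- |p + q| < ε whenever |p| < ½ ε and |q| < ½ ε
  split-ε : ∀ {ε} p q → ∣ p ∣ ℚ.< ½ ℚ.* ε → ∣ q ∣ ℚ.< ½ ℚ.* ε → ∣ p ℚ.+ q ∣ ℚ.< ε
  split-ε {ε} p q p< q< = ℚ.≤-<-trans (ℚ.∣p+q∣≤∣p∣+∣q∣ p q)
    (subst (_ ℚ.<_) (½ε+½ε ε) (ℚ.+-mono-< p< q<))

  ∣∣-swap : ∀ p q → ∣ p ℚ.- q ∣ ≡ ∣ q ℚ.- p ∣
  ∣∣-swap p q = trans (sym (ℚ.∣-p∣≡∣p∣ (p ℚ.- q)))
    (cong ∣_∣ (solve 2 (λ a b → :- (a :- b) := b :- a) refl p q))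

  ~-sym : ∀ {x y} → x ~ y → y ~ x
  ~-sym {x} {y} x~y .modulus ε 0<ε with N , h ← modulus x~y ε 0<ε =
    N , λ m n N≤m N≤n → subst (ℚ._< ε) (∣∣-swap (x n) (y m)) (h n m N≤n N≤m)

  ~-trans : ∀ {x y z} → x ~ y → y ~ z → x ~ z
  ~-trans {x} {y} {z} x~y y~z .modulus ε 0<ε
    with N₁ , h₁ ← modulus x~y _ (½ε>0 0<ε) | N₂ , h₂ ← modulus y~z _ (½ε>0 0<ε) = K , bound
    where
    K = N₁ ℕ.⊔ N₂
    bound : ∀ m n → K ℕ.≤ m → K ℕ.≤ n → ∣ x m ℚ.- z n ∣ ℚ.< ε
    bound m n K≤m K≤n = subst (λ t → ∣ t ∣ ℚ.< ε)
      (solve 3 (λ a b c → (a :- b) :+ (b :- c) := a :- c) refl (x m) (y K) (z n))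
      (split-ε (x m ℚ.- y K) (y K ℚ.- z n)
        (h₁ m K (≤ˡ N₁ N₂ K≤m) (ℕ.m≤m⊔n N₁ N₂))
        (h₂ K n (ℕ.m≤n⊔m N₁ N₂) (≤ʳ N₁ N₂ K≤n)))

  ~-const : ∀ q → (λ _ → q) ~ (λ _ → q)
  ~-const q .modulus ε 0<ε = 0 , λ _ _ _ _ →
    subst (λ t → ∣ t ∣ ℚ.< ε) (sym (ℚ.+-inverseʳ q)) 0<ε

  ~-neg : ∀ {x y} → x ~ y → (λ n → ℚ.- x n) ~ (λ n → ℚ.- y n)
  ~-neg {x} {y} x~y .modulus ε 0<ε with N , h ← modulus x~y ε 0<ε =
    N , λ m n N≤m N≤n → subst (ℚ._< ε)
      (trans (sym (ℚ.∣-p∣≡∣p∣ (x m ℚ.- y n)))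
        (cong ∣_∣ (solve 2 (λ a b → :- (a :- b) := :- a :- :- b) refl (x m) (y n))))
      (h m n N≤m N≤n)

  ~-+ : ∀ {x x′ y y′} → x ~ x′ → y ~ y′ → (λ n → x n ℚ.+ y n) ~ (λ n → x′ n ℚ.+ y′ n)
  ~-+ {x} {x′} {y} {y′} x~x′ y~y′ .modulus ε 0<ε
    with N₁ , h₁ ← modulus x~x′ _ (½ε>0 0<ε) | N₂ , h₂ ← modulus y~y′ _ (½ε>0 0<ε) =
    N₁ ℕ.⊔ N₂ , λ m n K≤m K≤n → subst (λ t → ∣ t ∣ ℚ.< ε)
      (solve 4 (λ a b c d → (a :- b) :+ (c :- d) := (a :+ c) :- (b :+ d)) refl
        (x m) (x′ n) (y m) (y′ n))
      (split-ε (x m ℚ.- x′ n) (y m ℚ.- y′ n)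
        (h₁ m n (≤ˡ N₁ N₂ K≤m) (≤ˡ N₁ N₂ K≤n))
        (h₂ m n (≤ʳ N₁ N₂ K≤m) (≤ʳ N₁ N₂ K≤n)))

  ~-bounded : ∀ {x y} → x ~ y →
    ∃[ B ] 0ℚ ℚ.< B × ∃[ N ] (∀ m → N ℕ.≤ m → ∣ x m ∣ ℚ.< B)
  ~-bounded {x} {y} x~y with N , h ← modulus x~y 1ℚ (ℚ.positive⁻¹ 1ℚ) =
    1ℚ ℚ.+ ∣ y N ∣ ,
    ℚ.+-mono-<-≤ (ℚ.positive⁻¹ 1ℚ) (ℚ.0≤∣p∣ (y N)) ,
    N , λ m N≤m → ℚ.≤-<-trans
      (subst (λ t → ∣ t ∣ ℚ.≤ ∣ x m ℚ.- y N ∣ ℚ.+ ∣ y N ∣)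
        (solve 2 (λ a b → (a :- b) :+ b := a) refl (x m) (y N))
        (ℚ.∣p+q∣≤∣p∣+∣q∣ (x m ℚ.- y N) (y N)))
      (ℚ.+-monoˡ-< ∣ y N ∣ (h m N N≤m ℕ.≤-refl))

  -- For B > 0 and ε > 0 there is δ > 0 with |p q| < ½ ε whenever |p| < B and |q| < δ.
  small-factor : ∀ {B ε} → 0ℚ ℚ.< B → 0ℚ ℚ.< ε →
    ∃[ δ ] 0ℚ ℚ.< δ × (∀ p q → ∣ p ∣ ℚ.< B → ∣ q ∣ ℚ.< δ → ∣ p ℚ.* q ∣ ℚ.< ½ ℚ.* ε)
  small-factor {B} {ε} 0<B 0<ε = δ , 0<δ , bound
    where
    instance
      B-pos : ℚ.Positive B
      B-pos = ℚ.positive 0<B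
      B-nonZero : ℚ.NonZero B
      B-nonZero = ℚ.pos⇒nonZero B
      1/B-pos : ℚ.Positive (ℚ.1/ B)
      1/B-pos = ℚ.1/pos⇒pos B
    δ : ℚ
    δ = ℚ.1/ B ℚ.* (½ ℚ.* ε)
    0<δ : 0ℚ ℚ.< δ
    0<δ = subst (ℚ._< δ) (ℚ.*-zeroʳ (ℚ.1/ B)) (ℚ.*-monoʳ-<-pos (ℚ.1/ B) (½ε>0 0<ε))
    Bδ : B ℚ.* δ ≡ ½ ℚ.* ε
    Bδ = trans (sym (ℚ.*-assoc B (ℚ.1/ B) (½ ℚ.* ε)))
      (trans (cong (ℚ._* (½ ℚ.* ε)) (ℚ.*-inverseʳ B)) (ℚ.*-identityˡ (½ ℚ.* ε)))
    bound : ∀ p q → ∣ p ∣ ℚ.< B → ∣ q ∣ ℚ.< δ → ∣ p ℚ.* q ∣ ℚ.< ½ ℚ.* ε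
    bound p q p<B q<δ = begin-strict
      ∣ p ℚ.* q ∣      ≡⟨ ℚ.∣p*q∣≡∣p∣*∣q∣ p q ⟩
      ∣ p ∣ ℚ.* ∣ q ∣  ≤⟨ ℚ.*-monoˡ-≤-nonNeg ∣ p ∣ {{ℚ.∣-∣-nonNeg p}} (ℚ.<⇒≤ q<δ) ⟩
      ∣ p ∣ ℚ.* δ      <⟨ ℚ.*-monoˡ-<-pos δ {{ℚ.positive 0<δ}} p<B ⟩
      B ℚ.* δ          ≡⟨ Bδ ⟩
      ½ ℚ.* ε          ∎
      where open ℚ.≤-Reasoning

  ~-* : ∀ {x x′ y y′} → x ~ x′ → y ~ y′ → (λ n → x n ℚ.* y n) ~ (λ n → x′ n ℚ.* y′ n)
  ~-* {x} {x′} {y} {y′} x~x′ y~y′ .modulus ε 0<ε =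
    let B₁ , 0<B₁ , M₁ , b₁ = ~-bounded x~x′
        B₂ , 0<B₂ , M₂ , b₂ = ~-bounded (~-sym y~y′)
        δ₁ , 0<δ₁ , s₁ = small-factor 0<B₁ 0<ε
        δ₂ , 0<δ₂ , s₂ = small-factor 0<B₂ 0<ε
        N₁ , h₁ = modulus y~y′ δ₁ 0<δ₁
        N₂ , h₂ = modulus x~x′ δ₂ 0<δ₂
        M = M₁ ℕ.⊔ M₂
        N = N₁ ℕ.⊔ N₂
    in M ℕ.⊔ N , λ m n K≤m K≤n → subst (λ t → ∣ t ∣ ℚ.< ε)
      (solve 4 (λ a b c d → a :* (c :- d) :+ d :* (a :- b) := a :* c :- b :* d) refl
        (x m) (x′ n) (y m) (y′ n))
      (split-ε (x m ℚ.* (y m ℚ.- y′ n)) (y′ n ℚ.* (x m ℚ.- x′ n))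
        (s₁ (x m) (y m ℚ.- y′ n)
          (b₁ m (≤ˡ M₁ M₂ (≤ˡ M N K≤m)))
          (h₁ m n (≤ˡ N₁ N₂ (≤ʳ M N K≤m)) (≤ˡ N₁ N₂ (≤ʳ M N K≤n))))
        (s₂ (y′ n) (x m ℚ.- x′ n)
          (b₂ n (≤ʳ M₁ M₂ (≤ˡ M N K≤n)))
          (h₂ m n (≤ʳ N₁ N₂ (≤ʳ M N K≤m)) (≤ʳ N₁ N₂ (≤ʳ M N K≤n)))))

  pointwise : ∀ {x} (y : ℝ) → (∀ n → x n ≡ seq y n) → x ~ seq y
  pointwise y x≗y .modulus ε 0<ε with N , h ← modulus (cauchy y) ε 0<ε =
    N , λ m n N≤m N≤n →
      subst (λ t → ∣ t ℚ.- seq y n ∣ ℚ.< ε) (sym (x≗y m)) (h m n N≤m N≤n)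

  pointwise-≃ : ∀ {x y} → (∀ n → seq x n ≡ seq y n) → x ≃ y
  pointwise-≃ {y = y} x≗y = mk≃ (pointwise y x≗y)

fromℚ : ℚ → ℝ
fromℚ q .seq    _ = q
fromℚ q .cauchy   = ~-const q

private
  infix  8 -ᴿ_
  infixl 7 _*ᴿ_
  infixl 6 _+ᴿ_

  _+ᴿ_ _*ᴿ_ : ℝ → ℝ → ℝ
  (x +ᴿ y) .seq n  = seq x n ℚ.+ seq y n
  (x +ᴿ y) .cauchy = ~-+ (cauchy x) (cauchy y)
  (x *ᴿ y) .seq n  = seq x n ℚ.* seq y n
  (x *ᴿ y) .cauchy = ~-* (cauchy x) (cauchy y)

  -ᴿ_ : ℝ → ℝ
  (-ᴿ x) .seq n  = ℚ.- seq x n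
  (-ᴿ x) .cauchy = ~-neg (cauchy x)

ℝ-commutativeRing : CommutativeRing 0ℓ 0ℓ
ℝ-commutativeRing = record
  { Carrier = ℝ
  ; _≈_ = _≃_
  ; _+_ = _+ᴿ_
  ; _*_ = _*ᴿ_
  ; -_  = -ᴿ_
  ; 0#  = fromℚ 0ℚ
  ; 1#  = fromℚ 1ℚ
  ; isCommutativeRing = record
    { isRing = record
      { +-isAbelianGroup = record
        { isGroup = record
          { isMonoid = record
            { isSemigroup = record
              { isMagma = record
                { isEquivalence = record
                  { refl  = λ {x} → mk≃ (cauchy x)
                  ; sym   = λ x≃y → mk≃ (~-sym (seq~ x≃y))
                  ; trans = λ x≃y y≃z → mk≃ (~-trans (seq~ x≃y) (seq~ y≃z))
                  }
                ; ∙-cong = λ x≃x′ y≃y′ → mk≃ (~-+ (seq~ x≃x′) (seq~ y≃y′))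
                }
              ; assoc = λ x y z → pointwise-≃ λ n → ℚ.+-assoc (seq x n) (seq y n) (seq z n)
              }
            ; identity = (λ x → pointwise-≃ λ n → ℚ.+-identityˡ (seq x n))
                       , (λ x → pointwise-≃ λ n → ℚ.+-identityʳ (seq x n))
            }
          ; inverse = (λ x → pointwise-≃ λ n → ℚ.+-inverseˡ (seq x n))
                    , (λ x → pointwise-≃ λ n → ℚ.+-inverseʳ (seq x n))
          ; ⁻¹-cong = λ x≃y → mk≃ (~-neg (seq~ x≃y))
          }
        ; comm = λ x y → pointwise-≃ λ n → ℚ.+-comm (seq x n) (seq y n)
        }
      ; *-cong = λ x≃x′ y≃y′ → mk≃ (~-* (seq~ x≃x′) (seq~ y≃y′))
      ; *-assoc = λ x y z → pointwise-≃ λ n → ℚ.*-assoc (seq x n) (seq y n) (seq z n)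
      ; *-identity = (λ x → pointwise-≃ λ n → ℚ.*-identityˡ (seq x n))
                   , (λ x → pointwise-≃ λ n → ℚ.*-identityʳ (seq x n))
      ; distrib = (λ x y z → pointwise-≃ λ n →
                    ℚ.*-distribˡ-+ (seq x n) (seq y n) (seq z n))
                , (λ x y z → pointwise-≃ λ n →
                    ℚ.*-distribʳ-+ (seq x n) (seq y n) (seq z n))
      }
    ; *-comm = λ x y → pointwise-≃ λ n → ℚ.*-comm (seq x n) (seq y n)
    }
  }

open CommutativeRing ℝ-commutativeRing public
  using (_≈_; _≉_; _+_; _*_; -_; 0#; 1#)
open CommutativeMonoidSum (CommutativeRing.+-commutativeMonoid ℝ-commutativeRing) public
  using (sum)

fromℕ : ℕ → ℝ
fromℕ k = fromℚ ((+ k) ℚ./ 1)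

private
  variable
    k m n p : ℕ

Matrix : ℕ → ℕ → Set
Matrix m n = Vector (Vector ℝ n) m

infix  4 _≈ⱽ_ _≈ᴹ_
infixl 6 _+ᴹ_
infixr 7 _•ⱽ_ _•ᴹ_
infixl 7 _*ᴹ_ _*ⱽ_

_≈ⱽ_ : Rel (Vector ℝ n) 0ℓ
v ≈ⱽ w = ∀ i → v i ≈ w i

_≈ᴹ_ : Rel (Matrix m n) 0ℓ
M ≈ᴹ P = ∀ i j → M i j ≈ P i j

_+ᴹ_ : Matrix m n → Matrix m n → Matrix m n
(M +ᴹ P) i j = M i j + P i j

_•ⱽ_ : ℝ → Vector ℝ n → Vector ℝ n
(c •ⱽ v) i = c * v i

_•ᴹ_ : ℝ → Matrix m n → Matrix m n
(c •ᴹ M) i j = c * M i j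

_*ᴹ_ : Matrix m n → Matrix n p → Matrix m p
(M *ᴹ P) i j = sum λ k → M i k * P k j

_*ⱽ_ : Matrix m n → Vector ℝ n → Vector ℝ m
(M *ⱽ v) i = sum λ k → M i k * v k

-- v wᵀ
outer : Vector ℝ m → Vector ℝ n → Matrix m n
outer v w i j = v i * w j

𝐞 : Vector ℝ n
𝐞 = replicate _ 1#

𝟎 : Vector ℝ n
𝟎 = replicate _ 0#

O : Matrix m n
O = replicate _ 𝟎

I : Matrix n n
I i j = if does (i Fin.≟ j) then 1# else 0#

Symmetric : Matrix n n → Set
Symmetric M = transpose M ≈ᴹ M

-- [ a  bᵀ  cᵀ ]
-- [ d  P   Q  ]
-- [ e  R   T  ]
blocks : ℝ → Vector ℝ n → Vector ℝ p →
         Vector ℝ k → Matrix k n → Matrix k p →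
         Vector ℝ m → Matrix m n → Matrix m p →
         Matrix (suc (k ℕ.+ m)) (suc (n ℕ.+ p))
blocks a b c d P Q e R T =
  (a ∷ (b ++ c)) ∷ (zipWith _∷_ d (zipWith _++_ P Q) ++ zipWith _∷_ e (zipWith _++_ R T))

rotateRight : Vector ℝ n → Vector ℝ n
rotateRight {zero}  v = v
rotateRight {suc _} v = last v ∷ init v

Circ : Vector ℝ n → Matrix n n
Circ a i = fold a rotateRight (toℕ i)

LaplacianLike : Matrix n n → Set
LaplacianLike L = Symmetric L × (∀ i → sum (L i) ≈ 0#)

record IsMoorePenroseInverse (M : Matrix m n) (X : Matrix n m) : Set where
  field
    MXM≈M    : M *ᴹ X *ᴹ M ≈ᴹ M
    XMX≈X    : X *ᴹ M *ᴹ X ≈ᴹ X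
    MX-symm  : Symmetric (M *ᴹ X)
    XM-symm  : Symmetric (X *ᴹ M)

data Walk {V : Set} (_—_ : Rel V 0ℓ) : ℕ → Rel V 0ℓ where
  nil  : ∀ {u} → Walk _—_ 0 u u
  cons : ∀ {ℓ u v w} → u — v → Walk _—_ ℓ v w → Walk _—_ (suc ℓ) u w

IsDistance : {V : Set} → Rel V 0ℓ → V → V → ℕ → Set
IsDistance _—_ u v d = Walk _—_ d u v × (∀ ℓ → Walk _—_ ℓ u v → d ℕ.≤ ℓ)

IsDistanceMatrix : {V : Set} → Rel V 0ℓ → Vector V n → Matrix n n → Set
IsDistanceMatrix _—_ vertices D =
  ∀ i j → ∃[ d ] IsDistance _—_ (vertices i) (vertices j) d × D i j ≈ fromℕ d

-- For H_n take N = n - 1; hub is v₀, rim i is v_{i+1} and pendant i is u_{i+1}.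

data HelmVertex (N : ℕ) : Set where
  hub     : HelmVertex N
  rim     : Fin N → HelmVertex N
  pendant : Fin N → HelmVertex N

data HelmEdge (N : ℕ) : Rel (HelmVertex N) 0ℓ where
  spoke : ∀ i → HelmEdge N hub (rim i)
  step  : ∀ i j → suc (toℕ i) ≡ toℕ j → HelmEdge N (rim i) (rim j)
  close : ∀ i j → suc (toℕ i) ≡ N → toℕ j ≡ 0 → HelmEdge N (rim i) (rim j)
  leaf  : ∀ i → HelmEdge N (rim i) (pendant i)

HelmAdjacent : ∀ N → Rel (HelmVertex N) 0ℓ
HelmAdjacent N = SymClosure (HelmEdge N)

-- 2 n - 1 for n ≥ 1, in the form matching the block partition.
helmOrder : ℕ → ℕ
helmOrder n = suc ((n ℕ.∸ 1) ℕ.+ (n ℕ.∸ 1))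

helmVertices : ∀ n → Vector (HelmVertex (n ℕ.∸ 1)) (helmOrder n)
helmVertices n = hub ∷ (rim ++ pendant)

IsHelmDistanceMatrix : ∀ n → Matrix (helmOrder n) (helmOrder n) → Set
IsHelmDistanceMatrix n = IsDistanceMatrix (HelmAdjacent (n ℕ.∸ 1)) (helmVertices n)

-- (2, 1, 0, …, 0, 1), intended for length N ≥ 3
𝐬 : ∀ N → Vector ℝ N
𝐬 N i =
  if does (toℕ i ℕ.≟ 0) then fromℕ 2
  else if does (toℕ i ℕ.≟ 1) ∨ does (suc (toℕ i) ℕ.≟ N) then 1#
  else 0#

{-# OPTIONS --safe #-}
-- Write N = n - 1, X = -½ L + α w wᵀ, e for the all-ones vector, P = D X. A vector is called
-- equitable if it is constant on the rim and constant on the pendants; S e = 4 e, so D maps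
-- equitable vectors to equitable ones by an invertible 3 × 3 matrix.
--
-- If X = D⁺, then X inverts D on the range of D, which contains the equitable vectors. As
-- X e = α w this determines α = 4 / (3N) and w, and then L on equitable vectors, that is
-- the hub row of L and the row sums of its blocks A, B, T. With these, D L = 2 (e wᵀ - P)
-- has P with rim and pendant blocks
--   ½ S (A + Bᵀ),  ½ S (B + T),  ½ S (A + Bᵀ) + Bᵀ,  ½ S (B + T) + T.
-- The pendant unit vectors lie in the range of D and are fixed by P; since P is symmetric,
-- P = diag(1, Q, I). Comparing blocks gives T = I, S B = - S and Q = - Bᵀ, so B is symmetric,
-- and P X = X becomes B A = - A and B B = - B.
-- Conversely these equations give P = diag(1, - B, I), from which the Penrose equations follow.
module Submission where

open import Defs
open import Algebra.Bundles using (CommutativeRing)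
import Algebra.Properties.Semiring.Sum as SemiringSum
import Algebra.Solver.Ring
import Algebra.Solver.Ring.AlmostCommutativeRing as ACR
open import Data.Bool.Base using (if_then_else_; _∨_)
open import Data.Fin.Base as Fin using (Fin; zero; suc; inject₁; splitAt; toℕ; _↑ˡ_; _↑ʳ_)
import Data.Fin.Properties as Fin
open import Data.Integer.Base using (+_)
import Data.Integer.Base as ℤ
import Data.Integer.Properties as ℤ
open import Data.Maybe.Base using (map)
open import Data.Nat.Base as ℕ using (ℕ; zero; suc; _≤_; _∸_; s≤s; z≤n)
open import Data.Nat.GeneralisedArithmetic using (fold)
import Data.Nat.Properties as ℕ
open import Data.Product.Base using (_×_; _,_; Σ-syntax)
open import Data.Rational.Base as ℚ using (ℚ; 1ℚ; ½; -½; _/_)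
import Data.Rational.Properties as ℚ
import Data.Rational.Unnormalised.Base as ℚᵘ
import Data.Rational.Unnormalised.Properties as ℚᵘ
open import Data.Sum.Base using (_⊎_; inj₁; inj₂)
open import Data.Vec.Functional using (Vector; _∷_; _++_; replicate; transpose; init; last)
open import Data.Vec.Functional.Properties using (lookup-++ˡ; lookup-++ʳ)
open import Function.Base using (_∘_)
open import Function.Bundles using (_⇔_; mk⇔)
open import Relation.Binary.PropositionalEquality.Core as ≡ using (_≡_; _≢_)
open import Relation.Binary.Construct.Closure.Symmetric using (fwd; bwd)
open import Relation.Nullary.Decidable using (Dec; yes; no; does; dec⇒maybe; dec-true; dec-false; _×-dec_; _⊎-dec_)
open import Relation.Nullary.Negation using (¬_; contradiction)

open CommutativeRing ℝ-commutativeRing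
  using (refl; sym; trans; reflexive; semiring; +-cong; +-congˡ; +-congʳ; *-cong; *-congˡ; *-congʳ
        ; -‿cong; *-comm; *-assoc; +-assoc; +-comm; +-identityˡ; +-identityʳ; *-identityˡ; *-identityʳ
        ; zeroˡ; zeroʳ)
open SemiringSum semiring using (sum-cong-≋; sum-init-last; ∑-distrib-+; ∑-comm; *-distribˡ-sum; *-distribʳ-sum)

-- The eigenvalues of `S` are `2 + 2 cos (2 π k / N)`, so `S`, and with it `D`, is singular exactly
-- when `N` is even. Singularity is also the reason why `B` appears at all. The conditions make
-- `- B` the orthogonal projection onto the range of `S`: it is idempotent by (v), it fixes the
-- columns of `S` by (iii), and (vi) transposed reads `- 2 B = S (A + B)`, so its columns lie in
-- that range. For odd `N` this forces `B = - I`. The constants come from one linear system. The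
-- equitable solution of `D u = e` has hub, rim and pendant values `(4 - N, -1, 2) / (3 N)`; its sum
-- is `α`, and dividing by that sum gives `w`. Division of reals is avoided: `1 / N` is a symbol `ρ`
-- with `N ρ = 1`, and the identities are polynomial modulo this relation.

-- Rational scalars and the ring solver over the reals.

fromℚ-+ : ∀ p q → fromℚ (p ℚ.+ q) ≈ fromℚ p + fromℚ q
fromℚ-+ p q = mk≃ (cauchy (fromℚ (p ℚ.+ q)))

fromℚ-* : ∀ p q → fromℚ (p ℚ.* q) ≈ fromℚ p * fromℚ q
fromℚ-* p q = mk≃ (cauchy (fromℚ (p ℚ.* q)))

-- Lets the ring solver normalise real polynomials with rational coefficients, whose equality is
-- decidable. Both sides of each law are the same constant sequence, so the proof that it is Cauchy
-- is the proof of equality.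
fromℚ-homomorphism :
  ℚ.+-*-rawRing ACR.-Raw-AlmostCommutative⟶ ACR.fromCommutativeRing ℝ-commutativeRing
fromℚ-homomorphism = record
  { ⟦_⟧    = fromℚ
  ; +-homo = fromℚ-+
  ; *-homo = fromℚ-*
  ; -‿homo = λ p → mk≃ (cauchy (fromℚ (ℚ.- p)))
  ; 0-homo = refl
  ; 1-homo = refl
  }

open Algebra.Solver.Ring ℚ.+-*-rawRing (ACR.fromCommutativeRing ℝ-commutativeRing)
  fromℚ-homomorphism
  (λ p q → map (λ p≡q → reflexive (≡.cong fromℚ p≡q)) (dec⇒maybe (p ℚ.≟ q)))
  using (Polynomial; solve; con; _:=_; _:+_; _:*_; :-_; _:-_)

⟨_⟩ : ∀ {m} → ℕ → Polynomial m
⟨ k ⟩ = con ((+ k) / 1)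

⅓ ¼ ¾ : ℚ
⅓ = (+ 1) / 3
¼ = (+ 1) / 4
¾ = (+ 3) / 4

private
  variable
    m n p : ℕ

-- The multiplier c is inferred from the polynomial identity proving the second argument,
-- so x ≈ y modulo several equations is proved by nesting modulo around one call of solve.
modulo : ∀ {x y a b c} → a ≈ b → x ≈ y + c * (a + - b) → x ≈ y
modulo {y = y} {b = b} {c} a≈b h = trans h
  (trans (+-congˡ (*-congˡ (+-congʳ a≈b)))
    (solve 3 (λ y b c → y :+ c :* (b :- b) := y) refl y b c))

-- `_/_` divides out a gcd and is stuck on a variable numerator, so this identity and the next two
-- are checked by cross-multiplication of unnormalised fractions.
suc/1 : ∀ k → (+ suc k) / 1 ≡ 1ℚ ℚ.+ (+ k) / 1
suc/1 k = ℚ.toℚᵘ-injective (ℚᵘ.≃-trans (ℚ.toℚᵘ-fromℚᵘ (ℚᵘ.mkℚᵘ (+ suc k) 0))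
  (ℚᵘ.≃-sym (ℚᵘ.≃-trans (ℚ.toℚᵘ-homo-+ 1ℚ ((+ k) / 1))
    (ℚᵘ.≃-trans (ℚᵘ.+-congʳ (ℚ.toℚᵘ 1ℚ) (ℚ.toℚᵘ-fromℚᵘ (ℚᵘ.mkℚᵘ (+ k) 0)))
      (ℚᵘ.*≡* (≡.cong (ℤ._* + 1) (≡.cong (λ t → + 1 ℤ.+ t) (ℤ.*-identityʳ (+ k)))))))))

/2 : ∀ k → (+ k) / 2 ≡ ½ ℚ.* ((+ k) / 1)
/2 k = ℚ.toℚᵘ-injective (ℚᵘ.≃-trans (ℚ.toℚᵘ-fromℚᵘ (ℚᵘ.mkℚᵘ (+ k) 1))
  (ℚᵘ.≃-sym (ℚᵘ.≃-trans (ℚ.toℚᵘ-homo-* ½ ((+ k) / 1))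
    (ℚᵘ.≃-trans (ℚᵘ.*-congˡ {ℚ.toℚᵘ ½} (ℚ.toℚᵘ-fromℚᵘ (ℚᵘ.mkℚᵘ (+ k) 0)))
      (ℚᵘ.*≡* (≡.cong (ℤ._* + 2) (ℤ.*-identityˡ (+ k))))))))

1/suc : ∀ k → (+ suc k) / 1 ℚ.* ((+ 1) / suc k) ≡ 1ℚ
1/suc k = ℚ.toℚᵘ-injective (ℚᵘ.≃-trans (ℚ.toℚᵘ-homo-* ((+ suc k) / 1) ((+ 1) / suc k))
  (ℚᵘ.≃-trans (ℚᵘ.*-cong (ℚ.toℚᵘ-fromℚᵘ (ℚᵘ.mkℚᵘ (+ suc k) 0)) (ℚ.toℚᵘ-fromℚᵘ (ℚᵘ.mkℚᵘ (+ 1) k)))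
    (ℚᵘ.*≡* (≡.trans (ℤ.*-identityʳ (+ suc k ℤ.* + 1))
      (≡.trans (ℤ.*-identityʳ (+ suc k))
        (≡.sym (≡.trans (ℤ.*-identityˡ (ℤ.+ (1 ℕ.* suc k))) (ℤ.*-identityˡ (+ suc k)))))))))

fromℕ-suc : ∀ k → fromℕ (suc k) ≈ 1# + fromℕ k
fromℕ-suc k = trans (reflexive (≡.cong fromℚ (suc/1 k))) (fromℚ-+ 1ℚ ((+ k) / 1))

-- Finite sums and products of matrices with vectors.

sum-const : ∀ n c → sum {n} (λ _ → c) ≈ fromℕ n * c
sum-const zero    c = sym (zeroˡ c)
sum-const (suc n) c = trans (+-congˡ (sum-const n c))
  (modulo (fromℕ-suc n)
    (solve 3 (λ c s t → c :+ s :* c := t :* c :+ :- c :* (t :- (⟨ 1 ⟩ :+ s))) refl c (fromℕ n) (fromℕ (suc n))))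

sum-linear : ∀ a b (v w : Vector ℝ n) →
  sum (λ k → a * v k + b * w k) ≈ a * sum v + b * sum w
sum-linear a b v w = trans (∑-distrib-+ (λ k → a * v k) (λ k → b * w k))
  (sym (+-cong (*-distribˡ-sum a v) (*-distribˡ-sum b w)))

-- `(M *ᴹ P) i j` unfolds to `(M *ⱽ (λ k → P k j)) i`, so the lemmas on `_*ⱽ_` also serve for matrix
-- products, one column at a time.
*ⱽ-congˡ : ∀ (M : Matrix m n) {v w : Vector ℝ n} → v ≈ⱽ w → (M *ⱽ v) ≈ⱽ (M *ⱽ w)
*ⱽ-congˡ M v≈w i = sum-cong-≋ λ k → *-congˡ (v≈w k)

*ⱽ-congʳ : ∀ {M P : Matrix m n} (v : Vector ℝ n) → M ≈ᴹ P → (M *ⱽ v) ≈ⱽ (P *ⱽ v)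
*ⱽ-congʳ v M≈P i = sum-cong-≋ λ k → *-congʳ (M≈P i k)

*ⱽ-linear : ∀ (M : Matrix m n) a b (v w : Vector ℝ n) i →
  (M *ⱽ (λ k → a * v k + b * w k)) i ≈ a * (M *ⱽ v) i + b * (M *ⱽ w) i
*ⱽ-linear M a b v w i = trans
  (sum-cong-≋ λ k → solve 5 (λ m a b v w → m :* (a :* v :+ b :* w) := a :* (m :* v) :+ b :* (m :* w))
    refl (M i k) a b (v k) (w k))
  (sum-linear a b (λ k → M i k * v k) (λ k → M i k * w k))

*ⱽ-const : ∀ (M : Matrix m n) c i → (M *ⱽ (λ _ → c)) i ≈ c * sum (M i)
*ⱽ-const M c i = trans (sum-cong-≋ λ k → *-comm (M i k) c) (sym (*-distribˡ-sum c (M i)))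

*ᴹ-*ⱽ-assoc : ∀ (M : Matrix m n) (P : Matrix n p) (v : Vector ℝ p) →
  (M *ᴹ P *ⱽ v) ≈ⱽ (M *ⱽ (P *ⱽ v))
*ᴹ-*ⱽ-assoc M P v i = trans
  (sum-cong-≋ λ l → *-distribʳ-sum (v l) (λ k → M i k * P k l))
  (trans (∑-comm λ l k → M i k * P k l * v l)
    (sum-cong-≋ λ k → trans (sum-cong-≋ λ l → *-assoc (M i k) (P k l) (v l))
      (sym (*-distribˡ-sum (M i k) (λ l → P k l * v l)))))

transpose-*ᴹ : ∀ {M : Matrix n n} {P : Matrix n n} → Symmetric M → Symmetric P →
  transpose (M *ᴹ P) ≈ᴹ P *ᴹ M
transpose-*ᴹ {M = M} {P} M-symm P-symm i j =
  sum-cong-≋ λ k → trans (*-cong (M-symm k j) (P-symm i k)) (*-comm (M k j) (P i k))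

I-symm : Symmetric (I {n})
I-symm zero    zero    = refl
I-symm zero    (suc j) = refl
I-symm (suc i) zero    = refl
I-symm (suc i) (suc j) = I-symm i j

I-*ⱽ : ∀ (v : Vector ℝ n) → (I *ⱽ v) ≈ⱽ v
I-*ⱽ {suc n} v zero = trans
  (+-cong (*-identityˡ (v zero)) (trans (sum-cong-≋ λ k → zeroˡ (v (suc k)))
      (trans (sum-const n 0#) (zeroʳ (fromℕ n)))))
  (+-identityʳ (v zero))
I-*ⱽ {suc n} v (suc i) = trans (+-cong (zeroˡ (v zero)) (I-*ⱽ (v ∘ suc) i)) (+-identityˡ (v (suc i)))

*ⱽ-I : ∀ (M : Matrix m n) j i → (M *ⱽ (λ k → I k j)) i ≈ M i j
*ⱽ-I M j i = trans
  (sum-cong-≋ λ k → trans (*-congˡ (I-symm j k)) (*-comm (M i k) (I j k)))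
  (I-*ⱽ (M i) j)

sum-I : ∀ (i : Fin n) → sum (I i) ≈ 1#
sum-I i = trans (sum-cong-≋ λ k → sym (*-identityʳ (I i k))) (I-*ⱽ 𝐞 i)

sum-++ : ∀ m (v : Vector ℝ (m ℕ.+ n)) → sum v ≈ sum (λ k → v (k ↑ˡ n)) + sum (λ k → v (m ↑ʳ k))
sum-++ zero    v = sym (+-identityˡ (sum v))
sum-++ (suc m) v = trans (+-congˡ (sum-++ m (v ∘ suc))) (sym (+-assoc _ _ _))

-- Matrices of order 1 + 2 N in block form

module Blocks (N : ℕ) where

  rimIx penIx : Fin N → Fin (suc (N ℕ.+ N))
  rimIx i = suc (i ↑ˡ N)
  penIx i = suc (N ↑ʳ i)

  -- Rim and pendant indices are not constructor forms of `Fin`, so case analysis on the block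
  -- partition has to go through `splitAt`.
  index-elim : ∀ {ℓ} (P : Fin (suc (N ℕ.+ N)) → Set ℓ) →
    P zero → (∀ i → P (rimIx i)) → (∀ i → P (penIx i)) → ∀ i → P i
  index-elim P h r p zero = h
  index-elim P h r p (suc i) with splitAt N i in eq
  ... | inj₁ j = ≡.subst (P ∘ suc) (Fin.splitAt⁻¹-↑ˡ eq) (r j)
  ... | inj₂ j = ≡.subst (P ∘ suc) (Fin.splitAt⁻¹-↑ʳ eq) (p j)

  sum-blocks : ∀ (v : Vector ℝ (suc (N ℕ.+ N))) →
    sum v ≈ v zero + (sum (v ∘ rimIx) + sum (v ∘ penIx))
  sum-blocks v = +-congˡ (sum-++ N (v ∘ suc))

  col : ℝ → Vector ℝ N → Vector ℝ N → Vector ℝ (suc (N ℕ.+ N))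
  col a x y = a ∷ (x ++ y)

  col-rim : ∀ a (x y : Vector ℝ N) i → col a x y (rimIx i) ≡ x i
  col-rim a x y = lookup-++ˡ x y

  col-pendant : ∀ a (x y : Vector ℝ N) i → col a x y (penIx i) ≡ y i
  col-pendant a x y = lookup-++ʳ x y

  col-≈ : ∀ {a} {x y : Vector ℝ N} {v} → v zero ≈ a → (∀ i → v (rimIx i) ≈ x i) →
    (∀ i → v (penIx i) ≈ y i) → v ≈ⱽ col a x y
  col-≈ {a = a} {x} {y} {v} h r p = index-elim (λ i → v i ≈ col a x y i) h
    (λ i → trans (r i) (reflexive (≡.sym (col-rim a x y i))))
    (λ i → trans (p i) (reflexive (≡.sym (col-pendant a x y i))))

  *ⱽ-col : ∀ (M : Matrix m (suc (N ℕ.+ N))) a x y i →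
    (M *ⱽ col a x y) i ≈
      M i zero * a + (sum (λ k → M i (rimIx k) * x k) + sum (λ k → M i (penIx k) * y k))
  *ⱽ-col M a x y i = trans (sum-blocks (λ k → M i k * col a x y k))
    (+-congˡ (+-cong (sum-cong-≋ λ k → *-congˡ (reflexive (col-rim a x y k)))
      (sum-cong-≋ λ k → *-congˡ (reflexive (col-pendant a x y k)))))

  equitable : ℝ → ℝ → ℝ → Vector ℝ (suc (N ℕ.+ N))
  equitable a b c = col a (replicate N b) (replicate N c)

  sum-equitable : ∀ a b c → sum (equitable a b c) ≈ a + (fromℕ N * b + fromℕ N * c)
  sum-equitable a b c = trans (sum-blocks (equitable a b c))
    (+-congˡ (+-cong
      (trans (sum-cong-≋ λ k → reflexive (col-rim a (replicate N b) (replicate N c) k)) (sum-const N b))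
      (trans (sum-cong-≋ λ k → reflexive (col-pendant a (replicate N b) (replicate N c) k)) (sum-const N c))))

-- Made for rows of blocks such as `c J - S`: they see a vector only through its sum and one row of
-- `S`. With `c = 0` it handles the block `- B`.
sum-affine : ∀ c {s t : Vector ℝ n} (x : Vector ℝ n) → (∀ k → t k ≈ c + - s k) →
  sum (λ k → t k * x k) ≈ c * sum x + - sum (λ k → s k * x k)
sum-affine c {s} {t} x t≈ = trans
  (sum-cong-≋ λ k → modulo (t≈ k)
    (solve 4 (λ c s t x → t :* x := c :* x :+ :- ⟨ 1 ⟩ :* (s :* x) :+ x :* (t :- (c :+ :- s)))
      refl c (s k) (t k) (x k)))
  (trans (sum-linear c (- 1#) x (λ k → s k * x k))
    (solve 3 (λ c x y → c :* x :+ :- ⟨ 1 ⟩ :* y := c :* x :+ :- y)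
      refl c (sum x) (sum λ k → s k * x k)))

sum-scale : ∀ c {t : Vector ℝ n} (x : Vector ℝ n) → (∀ k → t k ≈ c) →
  sum (λ k → t k * x k) ≈ c * sum x
sum-scale c x t≈ = trans (sum-cong-≋ λ k → *-congʳ (t≈ k)) (sym (*-distribˡ-sum c x))

1≉0 : 1# ≉ 0#
1≉0 1≈0 with N , h ← modulus (seq~ 1≈0) 1ℚ (ℚ.positive⁻¹ 1ℚ) =
  ℚ.<-irrefl ≡.refl (h N N ℕ.≤-refl ℕ.≤-refl)

B+I-*ⱽ : ∀ (B : Matrix n n) v i → ((B +ᴹ I) *ⱽ v) i ≈ (B *ⱽ v) i + v i
B+I-*ⱽ B v i = trans
  (sum-cong-≋ λ k → solve 3 (λ b d v → (b :+ d) :* v := b :* v :+ d :* v) refl (B i k) (I i k) (v k))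
  (trans (∑-distrib-+ (λ k → B i k * v k) (λ k → I i k * v k)) (+-congˡ (I-*ⱽ v i)))

-- Linear algebra of the helm distance matrix.

module HelmAlgebra {N : ℕ} (S : Matrix N N) where

  open Blocks N public

  -- The interface between graph and algebra: walks and distances serve only to establish these
  -- block entries.
  record IsHelmForm (D : Matrix (suc (N ℕ.+ N)) (suc (N ℕ.+ N))) : Set where
    field
      hub-hub : D zero zero ≈ 0#
      hub-rim : ∀ j → D zero (rimIx j) ≈ 1#
      hub-pen : ∀ j → D zero (penIx j) ≈ fromℕ 2
      rim-hub : ∀ i → D (rimIx i) zero ≈ 1#
      rim-rim : ∀ i j → D (rimIx i) (rimIx j) ≈ fromℕ 2 + - S i j
      rim-pen : ∀ i j → D (rimIx i) (penIx j) ≈ fromℕ 3 + - S i j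
      pen-hub : ∀ i → D (penIx i) zero ≈ fromℕ 2
      pen-rim : ∀ i j → D (penIx i) (rimIx j) ≈ fromℕ 3 + - S i j
      pen-pen : ∀ i j → D (penIx i) (penIx j) ≈ fromℕ 4 + - (S i j + fromℕ 2 * I i j)

  block-symmetric : ∀ {M : Matrix (suc (N ℕ.+ N)) (suc (N ℕ.+ N))} →
    (∀ i → M zero (rimIx i) ≈ M (rimIx i) zero) →
    (∀ i → M zero (penIx i) ≈ M (penIx i) zero) →
    (∀ i j → M (rimIx j) (rimIx i) ≈ M (rimIx i) (rimIx j)) →
    (∀ i j → M (rimIx i) (penIx j) ≈ M (penIx j) (rimIx i)) →
    (∀ i j → M (penIx j) (penIx i) ≈ M (penIx i) (penIx j)) →
    Symmetric M
  block-symmetric {M} hr hp rr rp pp = index-elim (λ i → ∀ j → M j i ≈ M i j)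
    (index-elim (λ j → M j zero ≈ M zero j) refl (λ j → sym (hr j)) (λ j → sym (hp j)))
    (λ i → index-elim (λ j → M j (rimIx i) ≈ M (rimIx i) j) (hr i) (rr i) (λ j → sym (rp i j)))
    (λ i → index-elim (λ j → M j (penIx i) ≈ M (penIx i) j) (hp i) (λ j → rp j i) (pp i))

  -- Of the circulant only symmetry and the row sum 4 enter the algebra, and `ρ` stands for `1 / N`.
  module Helm
    (S-symm : Symmetric S) (S-sum : ∀ i → sum (S i) ≈ fromℕ 4)
    (ρ : ℝ) (Nρ≈1 : fromℕ N * ρ ≈ 1#)
    (D : Matrix (suc (N ℕ.+ N)) (suc (N ℕ.+ N))) (D-form : IsHelmForm D) where

    private
      ν : ℝ
      ν = fromℕ N
      module D = IsHelmForm D-form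

    D-symm : Symmetric D
    D-symm = block-symmetric
      (λ i → trans (D.hub-rim i) (sym (D.rim-hub i)))
      (λ i → trans (D.hub-pen i) (sym (D.pen-hub i)))
      (λ i j → trans (D.rim-rim j i) (trans (+-congˡ (-‿cong (S-symm i j))) (sym (D.rim-rim i j))))
      (λ i j → trans (D.rim-pen i j) (trans (+-congˡ (-‿cong (S-symm j i))) (sym (D.pen-rim j i))))
      (λ i j → trans (D.pen-pen j i)
        (trans (+-congˡ (-‿cong (+-cong (S-symm i j) (*-congˡ (I-symm i j))))) (sym (D.pen-pen i j))))

    D-hub : ∀ a x y → (D *ⱽ col a x y) zero ≈ sum x + fromℕ 2 * sum y
    D-hub a x y = trans (*ⱽ-col D a x y zero) (trans
      (+-cong (*-congʳ D.hub-hub) (+-cong (sum-scale 1# x D.hub-rim) (sum-scale (fromℕ 2) y D.hub-pen)))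
      (solve 3 (λ a σ τ → ⟨ 0 ⟩ :* a :+ (⟨ 1 ⟩ :* σ :+ ⟨ 2 ⟩ :* τ) := σ :+ ⟨ 2 ⟩ :* τ)
        refl a (sum x) (sum y)))

    D-rim : ∀ a x y i → (D *ⱽ col a x y) (rimIx i) ≈
      a + (fromℕ 2 * sum x + fromℕ 3 * sum y) + - ((S *ⱽ x) i + (S *ⱽ y) i)
    D-rim a x y i = trans (*ⱽ-col D a x y (rimIx i)) (trans
      (+-cong (*-congʳ (D.rim-hub i))
        (+-cong (sum-affine (fromℕ 2) x (D.rim-rim i)) (sum-affine (fromℕ 3) y (D.rim-pen i))))
      (solve 5 (λ a σ τ s t →
          ⟨ 1 ⟩ :* a :+ (⟨ 2 ⟩ :* σ :+ :- s :+ (⟨ 3 ⟩ :* τ :+ :- t))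
          := a :+ (⟨ 2 ⟩ :* σ :+ ⟨ 3 ⟩ :* τ) :+ :- (s :+ t))
        refl a (sum x) (sum y) ((S *ⱽ x) i) ((S *ⱽ y) i)))

    D-pen : ∀ a x y i → (D *ⱽ col a x y) (penIx i) ≈
      fromℕ 2 * a + (fromℕ 3 * sum x + fromℕ 4 * sum y) + - ((S *ⱽ x) i + (S *ⱽ y) i)
        + - (fromℕ 2 * y i)
    D-pen a x y i = trans (*ⱽ-col D a x y (penIx i)) (trans
      (+-cong (*-congʳ (D.pen-hub i))
        (+-cong (sum-affine (fromℕ 3) x (D.pen-rim i))
          (trans (sum-affine (fromℕ 4) y (D.pen-pen i)) (+-congˡ (-‿cong S+2I)))))
      (solve 6 (λ a σ τ s t z →
          ⟨ 2 ⟩ :* a :+ (⟨ 3 ⟩ :* σ :+ :- s :+ (⟨ 4 ⟩ :* τ :+ :- (⟨ 1 ⟩ :* t :+ ⟨ 2 ⟩ :* z)))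
          := ⟨ 2 ⟩ :* a :+ (⟨ 3 ⟩ :* σ :+ ⟨ 4 ⟩ :* τ) :+ :- (s :+ t) :+ :- (⟨ 2 ⟩ :* z))
        refl a (sum x) (sum y) ((S *ⱽ x) i) ((S *ⱽ y) i) (y i)))
      where
      S+2I : sum (λ k → (S i k + fromℕ 2 * I i k) * y k) ≈ 1# * (S *ⱽ y) i + fromℕ 2 * y i
      S+2I = trans
        (sum-cong-≋ λ k → solve 3 (λ s d y → (s :+ ⟨ 2 ⟩ :* d) :* y := ⟨ 1 ⟩ :* (s :* y) :+ ⟨ 2 ⟩ :* (d :* y))
          refl (S i k) (I i k) (y k))
        (trans (sum-linear 1# (fromℕ 2) (λ k → S i k * y k) (λ k → I i k * y k))
          (+-congˡ (*-congˡ (I-*ⱽ y i))))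

    private
      S-const : ∀ b i → (S *ⱽ replicate N b) i ≈ b * fromℕ 4
      S-const b i = trans (*ⱽ-const S b i) (*-congˡ (S-sum i))

    D-equitable : ∀ a b c → (D *ⱽ equitable a b c) ≈ⱽ equitable
      (ν * b + fromℕ 2 * (ν * c))
      (a + (fromℕ 2 * (ν * b) + fromℕ 3 * (ν * c)) + - (b * fromℕ 4 + c * fromℕ 4))
      (fromℕ 2 * a + (fromℕ 3 * (ν * b) + fromℕ 4 * (ν * c)) + - (b * fromℕ 4 + c * fromℕ 4)
        + - (fromℕ 2 * c))
    D-equitable a b c = col-≈
      (trans (D-hub a _ _) (+-cong (sum-const N b) (*-congˡ (sum-const N c))))
      (λ i → trans (D-rim a _ _ i) (+-cong
        (+-congˡ (+-cong (*-congˡ (sum-const N b)) (*-congˡ (sum-const N c))))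
        (-‿cong (+-cong (S-const b i) (S-const c i)))))
      (λ i → trans (D-pen a _ _ i) (+-congʳ (+-cong
        (+-congˡ (+-cong (*-congˡ (sum-const N b)) (*-congˡ (sum-const N c))))
        (-‿cong (+-cong (S-const b i) (S-const c i))))))

    equitable-cong : ∀ {a a′ b b′ c c′} → a ≈ a′ → b ≈ b′ → c ≈ c′ →
      equitable a b c ≈ⱽ equitable a′ b′ c′
    equitable-cong {a} {b = b} {c = c} a≈ b≈ c≈ = col-≈ a≈
      (λ i → trans (reflexive (col-rim a (replicate N b) (replicate N c) i)) b≈)
      (λ i → trans (reflexive (col-pendant a (replicate N b) (replicate N c) i)) c≈)

    equitable-rim : ∀ a b c i → equitable a b c (rimIx i) ≈ b
    equitable-rim a b c i = reflexive (col-rim a (replicate N b) (replicate N c) i)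

    equitable-pen : ∀ a b c i → equitable a b c (penIx i) ≈ c
    equitable-pen a b c i = reflexive (col-pendant a (replicate N b) (replicate N c) i)

    equitable-const : ∀ c i → equitable c c c i ≈ c
    equitable-const c = index-elim (λ i → equitable c c c i ≈ c)
      refl (equitable-rim c c c) (equitable-pen c c c)

    -- The inverse of the 3 × 3 quotient matrix of D on equitable vectors, where ρ = 1 / N.
    pre₁ pre₂ pre₀ : ℝ → ℝ → ℝ → ℝ
    pre₁ a b c = fromℚ ⅓ * ((ν + - 1#) * (ρ * a) + c + - (fromℕ 2 * b))
    pre₂ a b c = fromℚ ½ * (ρ * a + - pre₁ a b c)
    pre₀ a b c = c + - b + - (ν * pre₁ a b c) + - ((ν + - fromℕ 2) * pre₂ a b c)

    pre : ℝ → ℝ → ℝ → Vector ℝ (suc (N ℕ.+ N))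
    pre a b c = equitable (pre₀ a b c) (pre₁ a b c) (pre₂ a b c)

    private
      :pre₁ :pre₂ :pre₀ : (ν ρ a b c : Polynomial m) → Polynomial m
      :pre₁ ν ρ a b c = con ⅓ :* ((ν :+ :- ⟨ 1 ⟩) :* (ρ :* a) :+ c :+ :- (⟨ 2 ⟩ :* b))
      :pre₂ ν ρ a b c = con ½ :* (ρ :* a :+ :- :pre₁ ν ρ a b c)
      :pre₀ ν ρ a b c = c :+ :- b :+ :- (ν :* :pre₁ ν ρ a b c) :+ :- ((ν :+ :- ⟨ 2 ⟩) :* :pre₂ ν ρ a b c)

    -- For rim value `x` and pendant value `y` the hub equation is `x + 2 y = ρ a`. The pendant
    -- equation minus twice the rim equation eliminates the hub value and yields `pre₁`; their plain
    -- difference yields `pre₀`. Since `pre₁` contains `ν * (ρ * a)` where `a` would do, only the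
    -- hub equation needs `Nρ≈1`.
    D-pre : ∀ a b c → (D *ⱽ pre a b c) ≈ⱽ equitable a b c
    D-pre a b c i = trans (D-equitable (pre₀ a b c) (pre₁ a b c) (pre₂ a b c) i) (equitable-cong
      (modulo Nρ≈1 (solve 5 (λ ν ρ a b c →
          ν :* :pre₁ ν ρ a b c :+ ⟨ 2 ⟩ :* (ν :* :pre₂ ν ρ a b c)
          := a :+ a :* (ν :* ρ :- ⟨ 1 ⟩))
        refl ν ρ a b c))
      (solve 5 (λ ν ρ a b c → let x = :pre₁ ν ρ a b c; y = :pre₂ ν ρ a b c in
          :pre₀ ν ρ a b c :+ (⟨ 2 ⟩ :* (ν :* x) :+ ⟨ 3 ⟩ :* (ν :* y)) :+ :- (x :* ⟨ 4 ⟩ :+ y :* ⟨ 4 ⟩)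
          := b)
        refl ν ρ a b c)
      (solve 5 (λ ν ρ a b c → let x = :pre₁ ν ρ a b c; y = :pre₂ ν ρ a b c in
          ⟨ 2 ⟩ :* :pre₀ ν ρ a b c :+ (⟨ 3 ⟩ :* (ν :* x) :+ ⟨ 4 ⟩ :* (ν :* y))
            :+ :- (x :* ⟨ 4 ⟩ :+ y :* ⟨ 4 ⟩) :+ :- (⟨ 2 ⟩ :* y)
          := c)
        refl ν ρ a b c) i)

    -- Chosen so that α° D w° = 𝐞 and the entries of w° sum to 1.
    α° : ℝ
    α° = fromℚ ((+ 4) / 3) * ρ

    w° : Vector ℝ (suc (N ℕ.+ N))
    w° = equitable (1# + - (fromℚ ¼ * ν)) (fromℚ (ℚ.- ¼)) (fromℚ ½)

    w°-rim : ∀ i → w° (rimIx i) ≈ fromℚ (ℚ.- ¼)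
    w°-rim = equitable-rim (1# + - (fromℚ ¼ * ν)) (fromℚ (ℚ.- ¼)) (fromℚ ½)

    w°-pen : ∀ i → w° (penIx i) ≈ fromℚ ½
    w°-pen = equitable-pen (1# + - (fromℚ ¼ * ν)) (fromℚ (ℚ.- ¼)) (fromℚ ½)

    D-w° : ∀ i → (D *ⱽ w°) i ≈ fromℚ ¾ * ν
    D-w° i = trans (D-equitable (1# + - (fromℚ ¼ * ν)) (fromℚ (ℚ.- ¼)) (fromℚ ½) i)
      (trans (equitable-cong
        (solve 1 (λ ν → ν :* con (ℚ.- ¼) :+ ⟨ 2 ⟩ :* (ν :* con ½) := con ¾ :* ν) refl ν)
        (solve 1 (λ ν → let x = con (ℚ.- ¼); y = con ½ in
            (⟨ 1 ⟩ :+ :- (con ¼ :* ν)) :+ (⟨ 2 ⟩ :* (ν :* x) :+ ⟨ 3 ⟩ :* (ν :* y))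
                :+ :- (x :* ⟨ 4 ⟩ :+ y :* ⟨ 4 ⟩)
            := con ¾ :* ν) refl ν)
        (solve 1 (λ ν → let x = con (ℚ.- ¼); y = con ½ in
            ⟨ 2 ⟩ :* (⟨ 1 ⟩ :+ :- (con ¼ :* ν)) :+ (⟨ 3 ⟩ :* (ν :* x) :+ ⟨ 4 ⟩ :* (ν :* y))
              :+ :- (x :* ⟨ 4 ⟩ :+ y :* ⟨ 4 ⟩) :+ :- (⟨ 2 ⟩ :* y)
            := con ¾ :* ν) refl ν) i)
        (equitable-const (fromℚ ¾ * ν) i))

    -- What equitable vectors see of `L`. The block sums run down columns because `D` is going to be
    -- applied to the columns of `L`.
    record IsHelmLaplacian (L : Matrix (suc (N ℕ.+ N)) (suc (N ℕ.+ N))) : Set where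
      field
        hub-hub : L zero zero ≈ fromℚ ½ * ν
        hub-rim : ∀ j → L zero (rimIx j) ≈ fromℚ -½
        hub-pen : ∀ j → L zero (penIx j) ≈ 0#
        rim-hub : ∀ i → L (rimIx i) zero ≈ fromℚ -½
        pen-hub : ∀ i → L (penIx i) zero ≈ 0#
        rim-rim : ∀ j → sum (λ k → L (rimIx k) (rimIx j)) ≈ fromℚ ((+ 3) / 2)
        pen-rim : ∀ j → sum (λ k → L (penIx k) (rimIx j)) ≈ - 1#
        rim-pen : ∀ j → sum (λ k → L (rimIx k) (penIx j)) ≈ - 1#
        pen-pen : ∀ j → sum (λ k → L (penIx k) (penIx j)) ≈ 1#

    X° : Matrix (suc (N ℕ.+ N)) (suc (N ℕ.+ N)) → Matrix (suc (N ℕ.+ N)) (suc (N ℕ.+ N))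
    X° L = fromℚ -½ •ᴹ L +ᴹ α° •ᴹ outer w° w°

    record IsBlockProjection (B : Matrix N N) (P : Matrix (suc (N ℕ.+ N)) (suc (N ℕ.+ N))) : Set where
      field
        hub-hub : P zero zero ≈ 1#
        hub-rim : ∀ j → P zero (rimIx j) ≈ 0#
        hub-pen : ∀ j → P zero (penIx j) ≈ 0#
        rim-hub : ∀ i → P (rimIx i) zero ≈ 0#
        rim-rim : ∀ i j → P (rimIx i) (rimIx j) ≈ - B i j
        rim-pen : ∀ i j → P (rimIx i) (penIx j) ≈ 0#
        pen-hub : ∀ i → P (penIx i) zero ≈ 0#
        pen-rim : ∀ i j → P (penIx i) (rimIx j) ≈ 0#
        pen-pen : ∀ i j → P (penIx i) (penIx j) ≈ I i j

    -- The blocks of the product `D X`.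

    module DX {L X} (L-lap : IsHelmLaplacian L) (X≈ : X ≈ᴹ X° L) where

      private
        module L = IsHelmLaplacian L-lap

      -- `D w°` is constant with value `¾ ν`, the inverse of `α°`, so the rank-one term adds just
      -- `w° j` to every row.
      DX-col : ∀ i j → (D *ᴹ X) i j ≈ fromℚ -½ * (D *ⱽ (λ k → L k j)) i + w° j
      DX-col i j = trans
        (*ⱽ-congˡ D (λ k → trans (X≈ k j)
          (solve 4 (λ l a v w → con -½ :* l :+ a :* (v :* w) := con -½ :* l :+ a :* w :* v)
            refl (L k j) α° (w° k) (w° j))) i)
        (trans (*ⱽ-linear D (fromℚ -½) (α° * w° j) (λ k → L k j) w° i)
          (modulo (D-w° i) (modulo Nρ≈1
            (solve 5 (λ d e ν ρ w →
                con -½ :* d :+ con ((+ 4) / 3) :* ρ :* w :* e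
                := con -½ :* d :+ w :+ con ((+ 4) / 3) :* ρ :* w :* (e :- con ¾ :* ν) :+ w :* (ν :* ρ :- ⟨ 1 ⟩))
              refl ((D *ⱽ (λ k → L k j)) i) ((D *ⱽ w°) i) ν ρ (w° j)))))

      private
        colⱼ : ∀ j → (λ k → L k j) ≈ⱽ col (L zero j) (λ k → L (rimIx k) j) (λ k → L (penIx k) j)
        colⱼ j = col-≈ refl (λ _ → refl) (λ _ → refl)

      -- The part of `D L` in a rim row that the hub row and the block sums of `L` do not determine.
      t : Fin N → Fin (suc (N ℕ.+ N)) → ℝ
      t i j = (S *ⱽ (λ k → L (rimIx k) j)) i + (S *ⱽ (λ k → L (penIx k) j)) i

      at-hub : ∀ j → (D *ᴹ X) zero j ≈
        fromℚ -½ * (sum (λ k → L (rimIx k) j) + fromℕ 2 * sum (λ k → L (penIx k) j)) + w° j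
      at-hub j = trans (DX-col zero j) (+-congʳ (*-congˡ (trans (*ⱽ-congˡ D (colⱼ j) zero) (D-hub _ _ _))))

      at-rim : ∀ i j → (D *ᴹ X) (rimIx i) j ≈
        fromℚ -½ * (L zero j + (fromℕ 2 * sum (λ k → L (rimIx k) j) + fromℕ 3 * sum (λ k → L (penIx k) j))
          + - t i j) + w° j
      at-rim i j = trans (DX-col (rimIx i) j)
        (+-congʳ (*-congˡ (trans (*ⱽ-congˡ D (colⱼ j) (rimIx i)) (D-rim _ _ _ i))))

      at-pen : ∀ i j → (D *ᴹ X) (penIx i) j ≈
        fromℚ -½ * (fromℕ 2 * L zero j
          + (fromℕ 3 * sum (λ k → L (rimIx k) j) + fromℕ 4 * sum (λ k → L (penIx k) j))
          + - t i j + - (fromℕ 2 * L (penIx i) j)) + w° j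
      at-pen i j = trans (DX-col (penIx i) j)
        (+-congʳ (*-congˡ (trans (*ⱽ-congˡ D (colⱼ j) (penIx i)) (D-pen _ _ _ i))))

      private
        sum-rim-hub : sum (λ k → L (rimIx k) zero) ≈ ν * fromℚ -½
        sum-rim-hub = trans (sum-cong-≋ L.rim-hub) (sum-const N (fromℚ -½))

        sum-pen-hub : sum (λ k → L (penIx k) zero) ≈ 0#
        sum-pen-hub = trans (sum-cong-≋ L.pen-hub) (trans (sum-const N 0#) (zeroʳ ν))

        t-hub : ∀ i → t i zero ≈ fromℚ -½ * fromℕ 4 + 0# * fromℕ 4
        t-hub i = +-cong (trans (*ⱽ-congˡ S L.rim-hub i) (S-const (fromℚ -½) i))
          (trans (*ⱽ-congˡ S L.pen-hub i) (S-const 0# i))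

      hub-hub : (D *ᴹ X) zero zero ≈ 1#
      hub-hub = trans (at-hub zero) (trans (+-congʳ (*-congˡ (+-cong sum-rim-hub (*-congˡ sum-pen-hub))))
        (solve 1 (λ ν → con -½ :* (ν :* con -½ :+ ⟨ 2 ⟩ :* ⟨ 0 ⟩) :+ (⟨ 1 ⟩ :+ :- (con ¼ :* ν)) :=
            ⟨ 1 ⟩) refl ν))

      rim-hub : ∀ i → (D *ᴹ X) (rimIx i) zero ≈ 0#
      rim-hub i = trans (at-rim i zero)
        (trans (+-congʳ (*-congˡ (+-cong
            (+-cong L.hub-hub (+-cong (*-congˡ sum-rim-hub) (*-congˡ sum-pen-hub))) (-‿cong (t-hub i)))))
        (solve 1 (λ ν → con -½ :* (con ½ :* ν :+ (⟨ 2 ⟩ :* (ν :* con -½) :+ ⟨ 3 ⟩ :* ⟨ 0 ⟩)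
            :+ :- (con -½ :* ⟨ 4 ⟩ :+ ⟨ 0 ⟩ :* ⟨ 4 ⟩)) :+ (⟨ 1 ⟩ :+ :- (con ¼ :* ν)) := ⟨ 0 ⟩) refl ν))

      pen-hub : ∀ i → (D *ᴹ X) (penIx i) zero ≈ 0#
      pen-hub i = trans (at-pen i zero)
        (trans (+-congʳ (*-congˡ (+-cong (+-cong (+-cong (*-congˡ L.hub-hub)
          (+-cong (*-congˡ sum-rim-hub) (*-congˡ sum-pen-hub))) (-‿cong (t-hub i)))
              (-‿cong (*-congˡ (L.pen-hub i))))))
        (solve 1 (λ ν → con -½ :* (⟨ 2 ⟩ :* (con ½ :* ν) :+ (⟨ 3 ⟩ :* (ν :* con -½) :+ ⟨ 4 ⟩ :* ⟨ 0 ⟩)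
            :+ :- (con -½ :* ⟨ 4 ⟩ :+ ⟨ 0 ⟩ :* ⟨ 4 ⟩) :+ :- (⟨ 2 ⟩ :* ⟨ 0 ⟩))
                :+ (⟨ 1 ⟩ :+ :- (con ¼ :* ν)) := ⟨ 0 ⟩) refl ν))

      hub-rim : ∀ j → (D *ᴹ X) zero (rimIx j) ≈ 0#
      hub-rim j = trans (at-hub (rimIx j))
        (trans (+-cong (*-congˡ (+-cong (L.rim-rim j) (*-congˡ (L.pen-rim j)))) (w°-rim j))
        (solve 0 (con -½ :* (con ((+ 3) / 2) :+ ⟨ 2 ⟩ :* :- ⟨ 1 ⟩) :+ con (ℚ.- ¼) := ⟨ 0 ⟩) refl))

      -- The constants cancel: the block sums contribute `-½ * (-½ + 3 - 3) = ¼` and the rank-one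
      -- term contributes `- ¼`. The same happens in the other rim and pendant columns, where only
      -- `t` and, in pendant rows, an entry of `L` survive.
      rim-rim : ∀ i j → (D *ᴹ X) (rimIx i) (rimIx j) ≈ fromℚ ½ * t i (rimIx j)
      rim-rim i j = trans (at-rim i (rimIx j))
        (trans (+-cong (*-congˡ (+-congʳ
            (+-cong (L.hub-rim j) (+-cong (*-congˡ (L.rim-rim j)) (*-congˡ (L.pen-rim j)))))) (w°-rim j))
        (solve 1 (λ t → con -½ :* (con -½ :+ (⟨ 2 ⟩ :* con ((+ 3) / 2) :+ ⟨ 3 ⟩ :* :- ⟨ 1 ⟩) :+ :- t)
            :+ con (ℚ.- ¼)
            := con ½ :* t) refl (t i (rimIx j))))

      pen-rim : ∀ i j → (D *ᴹ X) (penIx i) (rimIx j) ≈ fromℚ ½ * t i (rimIx j) + L (penIx i) (rimIx j)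
      pen-rim i j = trans (at-pen i (rimIx j))
        (trans (+-cong (*-congˡ (+-congʳ
            (+-congʳ (+-cong (*-congˡ (L.hub-rim j))
                (+-cong (*-congˡ (L.rim-rim j)) (*-congˡ (L.pen-rim j))))))) (w°-rim j))
        (solve 2 (λ t l → con -½ :* (⟨ 2 ⟩ :* con -½ :+ (⟨ 3 ⟩ :* con ((+ 3) / 2) :+ ⟨ 4 ⟩ :* :- ⟨ 1 ⟩)
            :+ :- t :+ :- (⟨ 2 ⟩ :* l)) :+ con (ℚ.- ¼)
            := con ½ :* t :+ l) refl (t i (rimIx j)) (L (penIx i) (rimIx j))))

      hub-pen : ∀ j → (D *ᴹ X) zero (penIx j) ≈ 0#
      hub-pen j = trans (at-hub (penIx j))
        (trans (+-cong (*-congˡ (+-cong (L.rim-pen j) (*-congˡ (L.pen-pen j)))) (w°-pen j))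
        (solve 0 (con -½ :* (:- ⟨ 1 ⟩ :+ ⟨ 2 ⟩ :* ⟨ 1 ⟩) :+ con ½ := ⟨ 0 ⟩) refl))

      rim-pen : ∀ i j → (D *ᴹ X) (rimIx i) (penIx j) ≈ fromℚ ½ * t i (penIx j)
      rim-pen i j = trans (at-rim i (penIx j))
        (trans (+-cong (*-congˡ (+-congʳ
            (+-cong (L.hub-pen j) (+-cong (*-congˡ (L.rim-pen j)) (*-congˡ (L.pen-pen j)))))) (w°-pen j))
        (solve 1 (λ t → con -½ :* (⟨ 0 ⟩ :+ (⟨ 2 ⟩ :* :- ⟨ 1 ⟩ :+ ⟨ 3 ⟩ :* ⟨ 1 ⟩) :+ :- t) :+ con ½
            := con ½ :* t) refl (t i (penIx j))))

      pen-pen : ∀ i j → (D *ᴹ X) (penIx i) (penIx j) ≈ fromℚ ½ * t i (penIx j) + L (penIx i) (penIx j)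
      pen-pen i j = trans (at-pen i (penIx j))
        (trans (+-cong (*-congˡ (+-congʳ
            (+-congʳ (+-cong (*-congˡ (L.hub-pen j))
                (+-cong (*-congˡ (L.rim-pen j)) (*-congˡ (L.pen-pen j))))))) (w°-pen j))
        (solve 2 (λ t l → con -½ :* (⟨ 2 ⟩ :* ⟨ 0 ⟩ :+ (⟨ 3 ⟩ :* :- ⟨ 1 ⟩ :+ ⟨ 4 ⟩ :* ⟨ 1 ⟩) :+ :- t
            :+ :- (⟨ 2 ⟩ :* l)) :+ con ½
            := con ½ :* t :+ l) refl (t i (penIx j)) (L (penIx i) (penIx j))))

    IsHelmLaplacian⇒LaplacianLike : ∀ {L} → Symmetric L → IsHelmLaplacian L → LaplacianLike L
    IsHelmLaplacian⇒LaplacianLike {L} L-symm L-lap = L-symm , λ i →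
      trans (sum-cong-≋ λ k → L-symm k i) (trans (sum-blocks (λ k → L k i)) (col-sum i))
      where
      module L = IsHelmLaplacian L-lap
      col-sum : ∀ i → L zero i + (sum (λ k → L (rimIx k) i) + sum (λ k → L (penIx k) i)) ≈ 0#
      col-sum = index-elim _
        (trans (+-cong L.hub-hub (+-cong
            (trans (sum-cong-≋ L.rim-hub) (sum-const N (fromℚ -½)))
            (trans (sum-cong-≋ L.pen-hub) (sum-const N 0#))))
          (solve 1 (λ ν → con ½ :* ν :+ (ν :* con -½ :+ ν :* ⟨ 0 ⟩) := ⟨ 0 ⟩) refl ν))
        (λ i → trans (+-cong (L.hub-rim i) (+-cong (L.rim-rim i) (L.pen-rim i)))
          (solve 0 (con -½ :+ (con ((+ 3) / 2) :+ :- ⟨ 1 ⟩) := ⟨ 0 ⟩) refl))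
        (λ i → trans (+-cong (L.hub-pen i) (+-cong (L.rim-pen i) (L.pen-pen i)))
          (solve 0 (⟨ 0 ⟩ :+ (:- ⟨ 1 ⟩ :+ ⟨ 1 ⟩) := ⟨ 0 ⟩) refl))

    -- The matrix `diag(1, - B, I)` and its action on `X`.

    module BlockProjection {B P} (P-proj : IsBlockProjection B P) where

      private
        module P = IsBlockProjection P-proj

      P-hub : ∀ v → (P *ⱽ v) zero ≈ v zero
      P-hub v = trans (sum-blocks (λ k → P zero k * v k)) (trans
        (+-cong (*-congʳ P.hub-hub)
          (+-cong (sum-scale 0# (v ∘ rimIx) P.hub-rim) (sum-scale 0# (v ∘ penIx) P.hub-pen)))
        (solve 3 (λ a x y → ⟨ 1 ⟩ :* a :+ (⟨ 0 ⟩ :* x :+ ⟨ 0 ⟩ :* y) := a)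
          refl (v zero) (sum (v ∘ rimIx)) (sum (v ∘ penIx))))

      P-rim : ∀ v i → (P *ⱽ v) (rimIx i) ≈ - (B *ⱽ (v ∘ rimIx)) i
      P-rim v i = trans (sum-blocks (λ k → P (rimIx i) k * v k)) (trans
        (+-cong (*-congʳ (P.rim-hub i))
          (+-cong
            (sum-affine 0# (v ∘ rimIx) (λ k → trans (P.rim-rim i k) (sym (+-identityˡ _))))
            (sum-scale 0# (v ∘ penIx) (P.rim-pen i))))
        (solve 4 (λ a x s y → ⟨ 0 ⟩ :* a :+ ((⟨ 0 ⟩ :* x :+ :- s) :+ ⟨ 0 ⟩ :* y) := :- s)
          refl (v zero) (sum (v ∘ rimIx)) ((B *ⱽ (v ∘ rimIx)) i) (sum (v ∘ penIx))))

      P-pen : ∀ v i → (P *ⱽ v) (penIx i) ≈ v (penIx i)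
      P-pen v i = trans (sum-blocks (λ k → P (penIx i) k * v k)) (trans
        (+-cong (*-congʳ (P.pen-hub i))
          (+-cong (sum-scale 0# (v ∘ rimIx) (P.pen-rim i))
            (trans (sum-cong-≋ λ k → *-congʳ (P.pen-pen i k)) (I-*ⱽ (v ∘ penIx) i))))
        (solve 3 (λ a x y → ⟨ 0 ⟩ :* a :+ (⟨ 0 ⟩ :* x :+ y) := y)
          refl (v zero) (sum (v ∘ rimIx)) (v (penIx i))))

      P-symm : Symmetric B → Symmetric P
      P-symm B-symm = block-symmetric
        (λ i → trans (P.hub-rim i) (sym (P.rim-hub i)))
        (λ i → trans (P.hub-pen i) (sym (P.pen-hub i)))
        (λ i j → trans (P.rim-rim j i) (trans (-‿cong (B-symm i j)) (sym (P.rim-rim i j))))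
        (λ i j → trans (P.rim-pen i j) (sym (P.pen-rim j i)))
        (λ i j → trans (P.pen-pen j i) (trans (I-symm i j) (sym (P.pen-pen i j))))

    record IsHelmBlock (A B : Matrix N N) (L : Matrix (suc (N ℕ.+ N)) (suc (N ℕ.+ N))) : Set where
      field
        rim-rim : ∀ i j → L (rimIx i) (rimIx j) ≈ A i j
        rim-pen : ∀ i j → L (rimIx i) (penIx j) ≈ B i j
        pen-rim : ∀ i j → L (penIx i) (rimIx j) ≈ B j i
        pen-pen : ∀ i j → L (penIx i) (penIx j) ≈ I i j

    module Projection {A B L X} (A-symm : Symmetric A) (B-symm : Symmetric B)
      (L-block : IsHelmBlock A B L) (L-lap : IsHelmLaplacian L) (X≈ : X ≈ᴹ X° L) where

      private
        module L = IsHelmBlock L-block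
        open DX L-lap X≈ using (t)

      -- `t` is `S (A + B)` here, while condition (vi) has `S` on the right; symmetry of all three
      -- matrices accounts for the swapped indices.
      t-rim : ∀ i j → t i (rimIx j) ≈ ((A +ᴹ B) *ᴹ S) j i
      t-rim i j = sym (trans
        (sum-cong-≋ λ k → trans
          (*-cong (+-cong (trans (A-symm k j) (sym (L.rim-rim k j))) (sym (L.pen-rim k j))) (S-symm i k))
          (solve 3 (λ a b s → (a :+ b) :* s := s :* a :+ s :* b)
            refl (L (rimIx k) (rimIx j)) (L (penIx k) (rimIx j)) (S i k)))
        (∑-distrib-+ (λ k → S i k * L (rimIx k) (rimIx j)) (λ k → S i k * L (penIx k) (rimIx j))))

      t-pen : ∀ i j → t i (penIx j) ≈ (B *ᴹ S) j i + S j i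
      t-pen i j = +-cong
        (sum-cong-≋ λ k → trans (*-cong (S-symm k i) (trans (L.rim-pen k j) (B-symm j k)))
            (*-comm (S k i) (B j k)))
        (trans (*ⱽ-congˡ S (λ k → L.pen-pen k j) i) (trans (*ⱽ-I S j i) (S-symm j i)))

      -- The left side is a rim row of `P X`. The rank-one part of `X` is constant along the rim, so
      -- `B e = - e` makes `- B` fix it. Comparison with `X-rim` reduces `P X = X` to the statement
      -- that `B` negates the rim part of every column of `L`, which is used in both directions.
      B-X : (B *ⱽ 𝐞) ≈ⱽ (- 1# •ⱽ 𝐞) → ∀ i j →
        - (B *ⱽ (λ k → X (rimIx k) j)) i ≈
        fromℚ ½ * (B *ⱽ (λ k → L (rimIx k) j)) i + α° * (fromℚ (ℚ.- ¼) * w° j)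
      B-X Be i j = trans
        (-‿cong (trans
          (*ⱽ-congˡ B (λ k → trans (X≈ (rimIx k) j)
            (trans (+-congˡ (*-congˡ (*-congʳ (w°-rim k)))) (+-congˡ (sym (*-identityʳ _))))) i)
          (*ⱽ-linear B (fromℚ -½) (α° * (fromℚ (ℚ.- ¼) * w° j)) (λ k → L (rimIx k) j) 𝐞 i)))
        (modulo (Be i) (solve 3 (λ x c e →
            :- (con -½ :* x :+ c :* e)
            := con ½ :* x :+ c :+ :- c :* (e :- :- ⟨ 1 ⟩ :* ⟨ 1 ⟩))
          refl ((B *ⱽ (λ k → L (rimIx k) j)) i) (α° * (fromℚ (ℚ.- ¼) * w° j)) ((B *ⱽ 𝐞) i)))

      X-rim : ∀ i j → X (rimIx i) j ≈ fromℚ -½ * L (rimIx i) j + α° * (fromℚ (ℚ.- ¼) * w° j)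
      X-rim i j = trans (X≈ (rimIx i) j) (+-congˡ (*-congˡ (*-congʳ (w°-rim i))))

    sum-w° : sum w° ≈ 1#
    sum-w° = trans (sum-equitable _ _ _)
      (solve 1 (λ ν → ⟨ 1 ⟩ :+ :- (con ¼ :* ν) :+ (ν :* con (ℚ.- ¼) :+ ν :* con ½) := ⟨ 1 ⟩) refl ν)

    α°-inverse : α° * (fromℚ ¾ * ν) ≈ 1#
    α°-inverse = modulo Nρ≈1
      (solve 2 (λ ν ρ → con ((+ 4) / 3) :* ρ :* (con ¾ :* ν) := ⟨ 1 ⟩ :+ ⟨ 1 ⟩ :* (ν :* ρ :- ⟨ 1 ⟩)) refl ν ρ)

    α°≉0 : α° ≉ 0#
    α°≉0 α°≈0 = 1≉0 (trans (sym α°-inverse) (trans (*-congʳ α°≈0) (zeroˡ _)))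

    -- From the block conditions to the Moore-Penrose inverse.

    module Sufficiency {A B L} (A-symm : Symmetric A) (B-symm : Symmetric B)
      (L-block : IsHelmBlock A B L) (L-lap : IsHelmLaplacian L)
      (Be : (B *ⱽ 𝐞) ≈ⱽ (- 1# •ⱽ 𝐞))
      (BS : (B *ᴹ S) ≈ᴹ (- 1# •ᴹ S))
      (BA : ((B +ᴹ I) *ᴹ A) ≈ᴹ O)
      (BB : ((B +ᴹ I) *ᴹ B) ≈ᴹ O)
      (ABS : (((A +ᴹ B) *ᴹ S) +ᴹ (fromℕ 2 •ᴹ B)) ≈ᴹ O) where

      private
        X P : Matrix (suc (N ℕ.+ N)) (suc (N ℕ.+ N))
        X = X° L
        P = D *ᴹ X
        X≈ : X ≈ᴹ X° L
        X≈ i j = refl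
        module L where
          open IsHelmBlock L-block public
          open IsHelmLaplacian L-lap public using (hub-hub; hub-rim; hub-pen; rim-hub; pen-hub)
        module DX′ = DX L-lap X≈
        open Projection A-symm B-symm L-block L-lap X≈

      L-symm : Symmetric L
      L-symm = block-symmetric
        (λ i → trans (L.hub-rim i) (sym (L.rim-hub i)))
        (λ i → trans (L.hub-pen i) (sym (L.pen-hub i)))
        (λ i j → trans (L.rim-rim j i) (trans (A-symm i j) (sym (L.rim-rim i j))))
        (λ i j → trans (L.rim-pen i j) (sym (L.pen-rim j i)))
        (λ i j → trans (L.pen-pen j i) (trans (I-symm i j) (sym (L.pen-pen i j))))

      X-symm : Symmetric X
      X-symm i j = +-cong (*-congˡ (L-symm i j)) (*-congˡ (*-comm (w° j) (w° i)))

      -- Condition (vi) turns `½ S (A + B)` into `- B`, and (iii) makes `½ S (B + I)` vanish; these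
      -- are the only non-constant terms of `D X`.
      P-proj : IsBlockProjection B P
      P-proj = record
        { hub-hub = DX′.hub-hub
        ; hub-rim = DX′.hub-rim
        ; hub-pen = DX′.hub-pen
        ; rim-hub = DX′.rim-hub
        ; rim-rim = λ i j → trans (DX′.rim-rim i j) (half i j)
        ; rim-pen = λ i j → trans (DX′.rim-pen i j) (trans (*-congˡ (t-pen≈0 i j)) (zeroʳ _))
        ; pen-hub = DX′.pen-hub
        ; pen-rim = λ i j → trans (DX′.pen-rim i j)
            (trans (+-cong (half i j) (trans (L.pen-rim i j) (B-symm i j)))
              (solve 1 (λ b → :- b :+ b := ⟨ 0 ⟩) refl (B i j)))
        ; pen-pen = λ i j → trans (DX′.pen-pen i j)
            (trans (+-cong (trans (*-congˡ (t-pen≈0 i j)) (zeroʳ _)) (L.pen-pen i j)) (+-identityˡ _))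
        }
        where
        half : ∀ i j → fromℚ ½ * DX′.t i (rimIx j) ≈ - B i j
        half i j = trans (*-congˡ (t-rim i j)) (modulo (ABS j i) (modulo (B-symm i j)
          (solve 3 (λ u b b′ →
              con ½ :* u := :- b :+ con ½ :* (u :+ ⟨ 2 ⟩ :* b′ :- ⟨ 0 ⟩) :+ :- ⟨ 1 ⟩ :* (b′ :- b))
            refl (((A +ᴹ B) *ᴹ S) j i) (B i j) (B j i))))
        t-pen≈0 : ∀ i j → DX′.t i (penIx j) ≈ 0#
        t-pen≈0 i j = trans (t-pen i j) (trans (+-congʳ (BS j i))
          (solve 1 (λ s → :- ⟨ 1 ⟩ :* s :+ s := ⟨ 0 ⟩) refl (S j i)))

      private
        open BlockProjection P-proj

        -- The rim part of a column of `L` is `-½ e`, a column of `A` or a column of `B`; these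
        -- cases are conditions (ii), (iv) and (v).
        B-L : ∀ i j → (B *ⱽ (λ k → L (rimIx k) j)) i ≈ - L (rimIx i) j
        B-L i = index-elim _
          (trans (*ⱽ-congˡ B (λ k → trans (L.rim-hub k) (sym (*-identityʳ _))) i)
            (trans (sum-cong-≋ λ k → solve 2 (λ b c → b :* (c :* ⟨ 1 ⟩) := c :* (b :* ⟨ 1 ⟩))
                refl (B i k) (fromℚ -½))
              (trans (sym (*-distribˡ-sum (fromℚ -½) (λ k → B i k * 1#)))
                (trans (*-congˡ (Be i)) (trans
                  (solve 0 (con -½ :* (:- ⟨ 1 ⟩ :* ⟨ 1 ⟩) := :- con -½) refl)
                  (-‿cong (sym (L.rim-hub i))))))))
          (λ j → trans (*ⱽ-congˡ B (λ k → L.rim-rim k j) i)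
            (trans (B+I A BA i j) (-‿cong (sym (L.rim-rim i j)))))
          (λ j → trans (*ⱽ-congˡ B (λ k → L.rim-pen k j) i)
            (trans (B+I B BB i j) (-‿cong (sym (L.rim-pen i j)))))
          where
          B+I : ∀ M → ((B +ᴹ I) *ᴹ M) ≈ᴹ O → ∀ i j → (B *ᴹ M) i j ≈ - M i j
          B+I M h i j = modulo (trans (sym (B+I-*ⱽ B (λ k → M k j) i)) (h i j))
            (solve 2 (λ x y → x := :- y :+ ⟨ 1 ⟩ :* (x :+ y :- ⟨ 0 ⟩)) refl ((B *ᴹ M) i j) (M i j))

        PX≈X : P *ᴹ X ≈ᴹ X
        PX≈X i j = index-elim (λ i → (P *ᴹ X) i j ≈ X i j)
          (P-hub (λ k → X k j))
          (λ i → trans (P-rim (λ k → X k j) i) (trans (B-X Be i j)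
            (trans (+-congʳ (trans (*-congˡ (B-L i j))
              (solve 1 (λ l → con ½ :* :- l := con -½ :* l) refl (L (rimIx i) j))))
              (sym (X-rim i j)))))
          (P-pen (λ k → X k j)) i

        -- `- B` fixes `e` by (ii) and the columns of `S` by (iii), and these span the rim parts of
        -- the columns of `D`.
        B-D : ∀ i c {t : Vector ℝ N} {j} → (∀ k → t k ≈ c + - S k j) → - (B *ⱽ t) i ≈ c + - S i j
        B-D i c {t} {j} t≈ = trans
          (-‿cong (trans (*ⱽ-congˡ B (λ k → trans (t≈ k)
              (solve 2 (λ c s → c :+ :- s := c :* ⟨ 1 ⟩ :+ :- ⟨ 1 ⟩ :* s) refl c (S k j))) i)
            (*ⱽ-linear B c (- 1#) 𝐞 (λ k → S k j) i)))
          (modulo (Be i) (modulo (BS i j) (solve 4 (λ c e u s →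
              :- (c :* e :+ :- ⟨ 1 ⟩ :* u)
              := c :+ :- s :+ :- c :* (e :- :- ⟨ 1 ⟩ :* ⟨ 1 ⟩) :+ ⟨ 1 ⟩ :* (u :- :- ⟨ 1 ⟩ :* s))
            refl c ((B *ⱽ 𝐞) i) ((B *ᴹ S) i j) (S i j))))

        PD≈D : P *ᴹ D ≈ᴹ D
        PD≈D i j = index-elim (λ i → (P *ᴹ D) i j ≈ D i j)
          (P-hub (λ k → D k j))
          (λ i → trans (P-rim (λ k → D k j) i) (rim-D i j))
          (P-pen (λ k → D k j)) i
          where
          rim-D : ∀ i j → - (B *ⱽ (λ k → D (rimIx k) j)) i ≈ D (rimIx i) j
          rim-D i = index-elim _
            (trans (-‿cong (trans (*ⱽ-congˡ B D.rim-hub i) (Be i)))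
              (trans (solve 0 (:- (:- ⟨ 1 ⟩ :* ⟨ 1 ⟩) := ⟨ 1 ⟩) refl) (sym (D.rim-hub i))))
            (λ j → trans (B-D i (fromℕ 2) (λ k → D.rim-rim k j)) (sym (D.rim-rim i j)))
            (λ j → trans (B-D i (fromℕ 3) (λ k → D.rim-pen k j)) (sym (D.rim-pen i j)))

        -- As `D` and `X` are symmetric, `X D` is the transpose of `D X`, and the block form shows
        -- that `P` is symmetric.
        XD≈P : X *ᴹ D ≈ᴹ P
        XD≈P i j = trans (sym (transpose-*ᴹ D-symm X-symm i j)) (P-symm B-symm i j)

      X°-isMoorePenroseInverse : IsMoorePenroseInverse D (X° L)
      X°-isMoorePenroseInverse = record
        { MXM≈M   = PD≈D
        ; XMX≈X   = λ i j → trans (*ⱽ-congʳ (λ k → X k j) XD≈P i) (PX≈X i j)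
        ; MX-symm = P-symm B-symm
        ; XM-symm = λ i j → trans (XD≈P j i) (trans (P-symm B-symm i j) (sym (XD≈P i j)))
        }

    -- From the Moore-Penrose inverse to the block conditions.

    module Necessity {L α w} (L-symm : Symmetric L) (L-row : ∀ i → sum (L i) ≈ 0#)
      (w-sum : sum w ≈ 1#)
      (mp : IsMoorePenroseInverse D (fromℚ -½ •ᴹ L +ᴹ α •ᴹ outer w w)) where

      private
        module MP = IsMoorePenroseInverse mp

        X : Matrix (suc (N ℕ.+ N)) (suc (N ℕ.+ N))
        X = fromℚ -½ •ᴹ L +ᴹ α •ᴹ outer w w

        X-symm : Symmetric X
        X-symm i j = +-cong (*-congˡ (L-symm i j)) (*-congˡ (*-comm (w j) (w i)))

        XD≈DX : X *ᴹ D ≈ᴹ D *ᴹ X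
        XD≈DX i j = trans (sym (transpose-*ᴹ D-symm X-symm i j)) (MP.MX-symm i j)

        DX-fixes-range : ∀ u {v} → (D *ⱽ u) ≈ⱽ v → (D *ᴹ X *ⱽ v) ≈ⱽ v
        DX-fixes-range u {v} Du≈v i = trans (*ⱽ-congˡ (D *ᴹ X) (λ k → sym (Du≈v k)) i)
          (trans (sym (*ᴹ-*ⱽ-assoc (D *ᴹ X) D u i)) (trans (*ⱽ-congʳ u MP.MXM≈M i) (Du≈v i)))

        -- `X D u = D X u`, and `D X` is known to fix `u` only if `u` itself lies in the range of
        -- `D`; the second preimage `z` certifies this.
        X-inverts-range : ∀ z u {v} → (D *ⱽ z) ≈ⱽ u → (D *ⱽ u) ≈ⱽ v → (X *ⱽ v) ≈ⱽ u
        X-inverts-range z u {v} Dz≈u Du≈v i = trans (*ⱽ-congˡ X (λ k → sym (Du≈v k)) i)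
          (trans (sym (*ᴹ-*ⱽ-assoc X D u i)) (trans (*ⱽ-congʳ u XD≈DX i) (DX-fixes-range z Dz≈u i)))

        X-apply : ∀ {β x} → X ≈ᴹ fromℚ -½ •ᴹ L +ᴹ β •ᴹ outer x x → ∀ v i →
          (X *ⱽ v) i ≈ fromℚ -½ * (L *ⱽ v) i + β * x i * sum (λ k → x k * v k)
        X-apply {β} {x} X≈ v i = trans
          (sum-cong-≋ λ k → trans (*-congʳ (X≈ i k))
            (solve 5 (λ l b y z v → (con -½ :* l :+ b :* (y :* z)) :* v := con -½ :* (l :* v)
                :+ b :* y :* (z :* v))
              refl (L i k) β (x i) (x k) (v k)))
          (sum-linear (fromℚ -½) (β * x i) (λ k → L i k * v k) (λ k → x k * v k))

        αw≈α°w° : ∀ i → α * w i ≈ α° * w° i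
        αw≈α°w° i = trans (sym Xe) (X-inverts-range z (λ k → α° * w° k) D-z D-α°w° i)
          where
          Xe : (X *ⱽ 𝐞) i ≈ α * w i
          Xe = trans (X-apply (λ _ _ → refl) 𝐞 i)
            (modulo (trans (sum-cong-≋ λ k → *-identityʳ (L i k)) (L-row i))
              (modulo (trans (sum-cong-≋ λ k → *-identityʳ (w k)) w-sum)
                (solve 4 (λ l a w s → con -½ :* l :+ a :* w :* s
                    := a :* w :+ con -½ :* (l :- ⟨ 0 ⟩) :+ a :* w :* (s :- ⟨ 1 ⟩))
                  refl ((L *ⱽ 𝐞) i) α (w i) (sum (λ k → w k * 1#)))))
          -- `α° w°` is equitable, so `pre` of its three values shows that it lies in the range of
          -- `D`.
          z : Vector ℝ (suc (N ℕ.+ N))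
          z = pre (α° * (1# + - (fromℚ ¼ * ν))) (α° * fromℚ (ℚ.- ¼)) (α° * fromℚ ½)
          D-z : (D *ⱽ z) ≈ⱽ (λ k → α° * w° k)
          D-z k = trans (D-pre _ _ _ k) (sym (col-≈ {v = λ k → α° * w° k} refl
            (λ i → *-congˡ (w°-rim i)) (λ i → *-congˡ (w°-pen i)) k))
          D-α°w° : (D *ⱽ (λ k → α° * w° k)) ≈ⱽ 𝐞
          D-α°w° i = trans
            (sum-cong-≋ λ k → solve 3 (λ d a w → d :* (a :* w) := a :* (d :* w)) refl (D i k) α° (w° k))
            (trans (sym (*-distribˡ-sum α° (λ k → D i k * w° k)))
              (trans (*-congˡ (D-w° i)) α°-inverse))

        -- Sum `α w = α° w°` over all entries: both `w` and `w°` have total 1.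
        α≈α° : α ≈ α°
        α≈α° = trans (scaled-sum α w w-sum) (trans (sum-cong-≋ αw≈α°w°) (sym (scaled-sum α° w° sum-w°)))
          where
          scaled-sum : ∀ a (v : Vector ℝ (suc (N ℕ.+ N))) → sum v ≈ 1# → a ≈ sum (λ k → a * v k)
          scaled-sum a v h = trans (sym (*-identityʳ a)) (trans (*-congˡ (sym h)) (*-distribˡ-sum a v))

        -- `¾ ν` inverts `α°`, hence also `α`, and so the common factor cancels.
        w≈w° : w ≈ⱽ w°
        w≈w° i = modulo α°-inverse (modulo α≈α° (modulo (αw≈α°w° i)
          (solve 5 (λ a a′ m w w′ →
              w := w′ :+ (w′ :- w) :* (a′ :* m :- ⟨ 1 ⟩) :+ :- (m :* w) :* (a :- a′)
                  :+ m :* (a :* w :- a′ :* w′))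
            refl α α° (fromℚ ¾ * ν) (w i) (w° i))))

        X≈X° : X ≈ᴹ X° L
        X≈X° i j = +-congˡ (*-cong α≈α° (*-cong (w≈w° i) (w≈w° j)))

        -- On an equitable vector `v`, `X v` is `pre` of its values, so
        -- `-½ L v + α° (w° · v) w° = X v` can be solved for `L v`.
        L-pre : ∀ a b c i → L i zero * a + (sum (λ k → L i (rimIx k)) * b + sum (λ k → L i (penIx k)) * c) ≈
          fromℚ ((+ 2) / 1) * (α° * w° i * ((1# + - (fromℚ ¼ * ν)) * a
              + (ν * (fromℚ (ℚ.- ¼) * b) + ν * (fromℚ ½ * c)))
            + - pre a b c i)
        L-pre a b c i = trans
          (sym (trans (*ⱽ-col L a (replicate N b) (replicate N c) i)
            (+-congˡ (+-cong (sym (*-distribʳ-sum b (λ k → L i (rimIx k))))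
                (sym (*-distribʳ-sum c (λ k → L i (penIx k))))))))
          (modulo (trans (sym (X-apply {α°} {w°} X≈X° (equitable a b c) i))
              -- `pre` is iterated because `pre a b c` has to be in the range of `D` as well.
              (X-inverts-range (pre (pre₀ a b c) (pre₁ a b c) (pre₂ a b c)) (pre a b c)
                  (D-pre (pre₀ a b c) (pre₁ a b c) (pre₂ a b c)) (D-pre a b c) i))
            (modulo dot (solve 5 (λ l β p d e →
                l := ⟨ 2 ⟩ :* (β :* e :+ :- p) :+ :- ⟨ 2 ⟩ :* (con -½ :* l :+ β :* d :- p)
                    :+ ⟨ 2 ⟩ :* β :* (d :- e))
              refl ((L *ⱽ equitable a b c) i) (α° * w° i) (pre a b c i)
                (sum (λ k → w° k * equitable a b c k))
                ((1# + - (fromℚ ¼ * ν)) * a + (ν * (fromℚ (ℚ.- ¼) * b) + ν * (fromℚ ½ * c))))))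
          where
          dot : sum (λ k → w° k * equitable a b c k) ≈
            (1# + - (fromℚ ¼ * ν)) * a + (ν * (fromℚ (ℚ.- ¼) * b) + ν * (fromℚ ½ * c))
          dot = trans (sum-blocks (λ k → w° k * equitable a b c k)) (+-congˡ (+-cong
            (trans (sum-cong-≋ λ k → *-cong (w°-rim k) (equitable-rim a b c k)) (sum-const N _))
            (trans (sum-cong-≋ λ k → *-cong (w°-pen k) (equitable-pen a b c k)) (sum-const N _))))

        -- The coefficients form the quotient matrix of `L`, with rows `(½ ν, -½ ν, 0)`,
        -- `(-½, 3/2, -1)` and `(0, -1, 1)`. Its columns, obtained at the three unit triples, are
        -- the hub column and the block row sums of `L`.
        L-equitable : ∀ a b c → (λ i → L i zero * a
            + (sum (λ k → L i (rimIx k)) * b + sum (λ k → L i (penIx k)) * c)) ≈ⱽ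
          equitable (fromℚ ½ * ν * (a + - b)) (fromℚ ½ * (fromℕ 3 * b + - a + - (fromℕ 2 * c))) (c + - b)
        L-equitable a b c = col-≈
          (trans (L-pre a b c zero) (modulo Nρ≈1 (solve 5 (λ ν ρ a b c →
              ⟨ 2 ⟩ :* (:α° ρ :* (⟨ 1 ⟩ :+ :- (con ¼ :* ν)) :* :dot ν a b c :+ :- :pre₀ ν ρ a b c)
              := con ½ :* ν :* (a :+ :- b) :+
                 (con ½ :* ν :* (a :+ :- b) :+ ⟨ 2 ⟩ :* (c :+ :- b)
                     :+ :- (con ⅓ :* (c :+ :- (⟨ 2 ⟩ :* b)) :* (ν :+ ⟨ 2 ⟩))) :* (ν :* ρ :- ⟨ 1 ⟩))
            refl ν ρ a b c)))
          (λ i → trans (L-pre a b c (rimIx i)) (trans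
            (*-congˡ (+-cong (*-congʳ (*-congˡ (w°-rim i)))
                (-‿cong (equitable-rim (pre₀ a b c) (pre₁ a b c) (pre₂ a b c) i))))
            (modulo Nρ≈1 (solve 5 (λ ν ρ a b c →
              ⟨ 2 ⟩ :* (:α° ρ :* con (ℚ.- ¼) :* :dot ν a b c :+ :- :pre₁ ν ρ a b c)
              := con ½ :* (⟨ 3 ⟩ :* b :+ :- a :+ :- (⟨ 2 ⟩ :* c))
                  :+ con ((+ 1) / 6) :* (b :+ :- (⟨ 3 ⟩ :* a) :+ :- (⟨ 2 ⟩ :* c)) :* (ν :* ρ :- ⟨ 1 ⟩))
            refl ν ρ a b c))))
          (λ i → trans (L-pre a b c (penIx i)) (trans
            (*-congˡ (+-cong (*-congʳ (*-congˡ (w°-pen i)))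
                (-‿cong (equitable-pen (pre₀ a b c) (pre₁ a b c) (pre₂ a b c) i))))
            (modulo Nρ≈1 (solve 5 (λ ν ρ a b c →
              ⟨ 2 ⟩ :* (:α° ρ :* con ½ :* :dot ν a b c :+ :- :pre₂ ν ρ a b c)
              := c :+ :- b :+ con ⅓ :* (⟨ 2 ⟩ :* c :+ :- b) :* (ν :* ρ :- ⟨ 1 ⟩))
            refl ν ρ a b c))))
          where
          :α° : Polynomial m → Polynomial m
          :α° ρ = con ((+ 4) / 3) :* ρ
          :dot : (ν a b c : Polynomial m) → Polynomial m
          :dot ν a b c = (⟨ 1 ⟩ :+ :- (con ¼ :* ν)) :* a :+ (ν :* (con (ℚ.- ¼) :* b) :+ ν :* (con ½ :* c))

        L-hub : (λ i → L i zero) ≈ⱽ equitable (fromℚ ½ * ν) (fromℚ -½) 0#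
        L-hub i = trans (solve 3 (λ l x y → l := l :* ⟨ 1 ⟩ :+ (x :* ⟨ 0 ⟩ :+ y :* ⟨ 0 ⟩))
            refl (L i zero) (sum (λ k → L i (rimIx k))) (sum (λ k → L i (penIx k))))
          (trans (L-equitable 1# 0# 0# i) (equitable-cong
            (solve 1 (λ ν → con ½ :* ν :* (⟨ 1 ⟩ :+ :- ⟨ 0 ⟩) := con ½ :* ν) refl ν)
            (solve 0 (con ½ :* (⟨ 3 ⟩ :* ⟨ 0 ⟩ :+ :- ⟨ 1 ⟩ :+ :- (⟨ 2 ⟩ :* ⟨ 0 ⟩)) := con -½) refl)
            (solve 0 (⟨ 0 ⟩ :+ :- ⟨ 0 ⟩ := ⟨ 0 ⟩) refl) i))

        L-sum-rim : (λ i → sum (λ k → L i (rimIx k))) ≈ⱽ equitable (- (fromℚ ½ * ν)) (fromℚ ((+ 3) / 2)) (- 1#)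
        L-sum-rim i = trans (solve 3 (λ l x y → x := l :* ⟨ 0 ⟩ :+ (x :* ⟨ 1 ⟩ :+ y :* ⟨ 0 ⟩))
            refl (L i zero) (sum (λ k → L i (rimIx k))) (sum (λ k → L i (penIx k))))
          (trans (L-equitable 0# 1# 0# i) (equitable-cong
            (solve 1 (λ ν → con ½ :* ν :* (⟨ 0 ⟩ :+ :- ⟨ 1 ⟩) := :- (con ½ :* ν)) refl ν)
            (solve 0 (con ½ :* (⟨ 3 ⟩ :* ⟨ 1 ⟩ :+ :- ⟨ 0 ⟩ :+ :- (⟨ 2 ⟩ :* ⟨ 0 ⟩)) := con ((+ 3) / 2)) refl)
            (solve 0 (⟨ 0 ⟩ :+ :- ⟨ 1 ⟩ := :- ⟨ 1 ⟩) refl) i))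

        L-sum-pen : (λ i → sum (λ k → L i (penIx k))) ≈ⱽ equitable 0# (- 1#) 1#
        L-sum-pen i = trans (solve 3 (λ l x y → y := l :* ⟨ 0 ⟩ :+ (x :* ⟨ 0 ⟩ :+ y :* ⟨ 1 ⟩))
            refl (L i zero) (sum (λ k → L i (rimIx k))) (sum (λ k → L i (penIx k))))
          (trans (L-equitable 0# 0# 1# i) (equitable-cong
            (solve 1 (λ ν → con ½ :* ν :* (⟨ 0 ⟩ :+ :- ⟨ 0 ⟩) := ⟨ 0 ⟩) refl ν)
            (solve 0 (con ½ :* (⟨ 3 ⟩ :* ⟨ 0 ⟩ :+ :- ⟨ 0 ⟩ :+ :- (⟨ 2 ⟩ :* ⟨ 1 ⟩)) := :- ⟨ 1 ⟩) refl)
            (solve 0 (⟨ 1 ⟩ :+ :- ⟨ 0 ⟩ := ⟨ 1 ⟩) refl) i))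

      A B : Matrix N N
      A i j = L (rimIx i) (rimIx j)
      B i j = L (rimIx i) (penIx j)

      L-lap : IsHelmLaplacian L
      L-lap = record
        { hub-hub = L-hub zero
        ; hub-rim = λ j → trans (L-symm (rimIx j) zero) (rim-hub j)
        ; hub-pen = λ j → trans (L-symm (penIx j) zero) (pen-hub j)
        ; rim-hub = rim-hub
        ; pen-hub = pen-hub
        ; rim-rim = λ j → trans (sum-cong-≋ λ k → L-symm (rimIx j) (rimIx k))
            (trans (L-sum-rim (rimIx j)) (equitable-rim (- (fromℚ ½ * ν)) (fromℚ ((+ 3) / 2)) (- 1#) j))
        ; pen-rim = λ j → trans (sum-cong-≋ λ k → L-symm (rimIx j) (penIx k))
            (trans (L-sum-pen (rimIx j)) (equitable-rim 0# (- 1#) 1# j))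
        ; rim-pen = λ j → trans (sum-cong-≋ λ k → L-symm (penIx j) (rimIx k))
            (trans (L-sum-rim (penIx j)) (equitable-pen (- (fromℚ ½ * ν)) (fromℚ ((+ 3) / 2)) (- 1#) j))
        ; pen-pen = λ j → trans (sum-cong-≋ λ k → L-symm (penIx j) (penIx k))
            (trans (L-sum-pen (penIx j)) (equitable-pen 0# (- 1#) 1# j))
        }
        where
        rim-hub : ∀ i → L (rimIx i) zero ≈ fromℚ -½
        rim-hub i = trans (L-hub (rimIx i)) (equitable-rim (fromℚ ½ * ν) (fromℚ -½) 0# i)
        pen-hub : ∀ i → L (penIx i) zero ≈ 0#
        pen-hub i = trans (L-hub (penIx i)) (equitable-pen (fromℚ ½ * ν) (fromℚ -½) 0# i)

      private
        P : Matrix (suc (N ℕ.+ N)) (suc (N ℕ.+ N))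
        P = D *ᴹ X

        module DX′ = DX L-lap X≈X°

        -- D (½ e_v - ½ e_u) = e_u - ½ 𝐞 for a rim vertex v and its pendant u, so e_u lies in the range of D.
        P-pen : ∀ j → (λ i → P i (penIx j)) ≈ⱽ col 0# 𝟎 (λ k → I k j)
        P-pen j i = trans (sym P-col) (DX-fixes-range (λ k → 1# * u₁ k + 1# * u₂ k) D-u i)
          where
          c : ℝ → Fin N → ℝ
          c a k = a * I k j
          u₁ u₂ : Vector ℝ (suc (N ℕ.+ N))
          u₁ = col 0# (c (fromℚ ½)) (c (fromℚ -½))
          u₂ = pre (fromℚ ½) (fromℚ ½) (fromℚ ½)
          P-col : (P *ⱽ col 0# 𝟎 (λ k → I k j)) i ≈ P i (penIx j)
          P-col = trans (*ⱽ-col P 0# 𝟎 (λ k → I k j) i) (trans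
            (+-congˡ (+-cong (trans (sum-cong-≋ λ k → zeroʳ (P i (rimIx k))) (sum-const N 0#))
              (*ⱽ-I (λ i k → P i (penIx k)) j i)))
            (solve 3 (λ p n q → p :* ⟨ 0 ⟩ :+ (n :* ⟨ 0 ⟩ :+ q) := q) refl (P i zero) ν (P i (penIx j))))
          sum-c : ∀ a → sum (c a) ≈ a
          sum-c a = trans (sym (*-distribˡ-sum a (λ k → I k j)))
            (trans (*-congˡ (trans (sum-cong-≋ λ k → I-symm j k) (sum-I j))) (*-identityʳ a))
          S-c : ∀ a i → (S *ⱽ c a) i ≈ a * S i j
          S-c a i = trans
            (sum-cong-≋ λ k → solve 3 (λ s a d → s :* (a :* d) := a :* (s :* d)) refl (S i k) a (I k j))
            (trans (sym (*-distribˡ-sum a (λ k → S i k * I k j))) (*-congˡ (*ⱽ-I S j i)))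
          D-u₁ : (D *ⱽ u₁) ≈ⱽ col (fromℚ -½) (λ _ → fromℚ -½) (λ i → fromℚ -½ + I i j)
          D-u₁ = col-≈
            (trans (D-hub 0# _ _) (trans (+-cong (sum-c (fromℚ ½)) (*-congˡ (sum-c (fromℚ -½))))
              (solve 0 (con ½ :+ ⟨ 2 ⟩ :* con -½ := con -½) refl)))
            (λ i → trans (D-rim 0# _ _ i) (trans
              (+-cong (+-congˡ (+-cong (*-congˡ (sum-c (fromℚ ½))) (*-congˡ (sum-c (fromℚ -½)))))
                (-‿cong (+-cong (S-c (fromℚ ½) i) (S-c (fromℚ -½) i))))
              (solve 1 (λ s → ⟨ 0 ⟩ :+ (⟨ 2 ⟩ :* con ½ :+ ⟨ 3 ⟩ :* con -½) :+ :- (con ½ :* s :+ con -½ :* s)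
                := con -½) refl (S i j))))
            (λ i → trans (D-pen 0# _ _ i) (trans
              (+-congʳ (+-cong (+-congˡ (+-cong (*-congˡ (sum-c (fromℚ ½))) (*-congˡ (sum-c (fromℚ -½)))))
                (-‿cong (+-cong (S-c (fromℚ ½) i) (S-c (fromℚ -½) i)))))
              (solve 2 (λ s d → ⟨ 2 ⟩ :* ⟨ 0 ⟩ :+ (⟨ 3 ⟩ :* con ½ :+ ⟨ 4 ⟩ :* con -½)
                  :+ :- (con ½ :* s :+ con -½ :* s) :+ :- (⟨ 2 ⟩ :* (con -½ :* d))
                := con -½ :+ d) refl (S i j) (I i j))))
          D-u : (D *ⱽ (λ k → 1# * u₁ k + 1# * u₂ k)) ≈ⱽ col 0# 𝟎 (λ k → I k j)
          D-u i = trans (*ⱽ-linear D 1# 1# u₁ u₂ i) (trans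
            (+-cong (*-congˡ (D-u₁ i)) (*-congˡ
                (trans (D-pre (fromℚ ½) (fromℚ ½) (fromℚ ½) i) (equitable-const (fromℚ ½) i))))
            (col-≈ {v = λ i → 1# * col (fromℚ -½) (λ _ → fromℚ -½) (λ i → fromℚ -½ + I i j) i + 1# * fromℚ ½}
              cancel
              (λ i → trans (+-congʳ (*-congˡ (reflexive
                  (col-rim (fromℚ -½) (λ _ → fromℚ -½) (λ i → fromℚ -½ + I i j) i)))) cancel)
              (λ i → trans (+-congʳ (*-congˡ (reflexive
                  (col-pendant (fromℚ -½) (λ _ → fromℚ -½) (λ i → fromℚ -½ + I i j) i))))
                (solve 1 (λ d → ⟨ 1 ⟩ :* (con -½ :+ d) :+ ⟨ 1 ⟩ :* con ½ := d) refl (I i j))) i))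
            where
            cancel : 1# * fromℚ -½ + 1# * fromℚ ½ ≈ 0#
            cancel = solve 0 (⟨ 1 ⟩ :* con -½ :+ ⟨ 1 ⟩ :* con ½ := ⟨ 0 ⟩) refl

        P-rim-pen : ∀ i j → P (rimIx i) (penIx j) ≈ 0#
        P-rim-pen i j = trans (P-pen j (rimIx i)) (reflexive (col-rim 0# 𝟎 (λ k → I k j) i))

        P-pen-pen : ∀ i j → P (penIx i) (penIx j) ≈ I i j
        P-pen-pen i j = trans (P-pen j (penIx i)) (reflexive (col-pendant 0# 𝟎 (λ k → I k j) i))

        P-pen-rim : ∀ i j → P (penIx i) (rimIx j) ≈ 0#
        P-pen-rim i j = trans (MP.MX-symm (rimIx j) (penIx i)) (P-rim-pen j i)

        ½t-pen : ∀ i j → fromℚ ½ * DX′.t i (penIx j) ≈ 0#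
        ½t-pen i j = trans (sym (DX′.rim-pen i j)) (P-rim-pen i j)

        ½t-rim : ∀ i j → fromℚ ½ * DX′.t i (rimIx j) + L (penIx i) (rimIx j) ≈ 0#
        ½t-rim i j = trans (sym (DX′.pen-rim i j)) (P-pen-rim i j)

        -- In the rim columns, row `i` of the rim and row `i` of the pendants carry the same term
        -- `½ t`. The pendant row is zero there, which identifies this term with an entry of `- Bᵀ`.
        P-rim-rim : ∀ i j → P (rimIx i) (rimIx j) ≈ - B j i
        P-rim-rim i j = trans (DX′.rim-rim i j) (modulo (½t-rim i j) (modulo (L-symm (rimIx j) (penIx i))
          (solve 3 (λ t l b → con ½ :* t :=
              :- b :+ ⟨ 1 ⟩ :* (con ½ :* t :+ l :- ⟨ 0 ⟩) :+ :- ⟨ 1 ⟩ :* (l :- b))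
            refl (DX′.t i (rimIx j)) (L (penIx i) (rimIx j)) (B j i))))

        T≈I : ∀ i j → L (penIx i) (penIx j) ≈ I i j
        T≈I i j = trans (modulo (½t-pen i j)
          (solve 2 (λ t l → l := con ½ :* t :+ l :+ :- ⟨ 1 ⟩ :* (con ½ :* t :- ⟨ 0 ⟩))
            refl (DX′.t i (penIx j)) (L (penIx i) (penIx j))))
          (trans (sym (DX′.pen-pen i j)) (P-pen-pen i j))

      A-symm : Symmetric A
      A-symm i j = L-symm (rimIx i) (rimIx j)

      B-symm : Symmetric B
      B-symm i j = modulo (trans (sym (P-rim-rim i j)) (trans (MP.MX-symm (rimIx j) (rimIx i)) (P-rim-rim j i)))
        (solve 2 (λ b b′ → b := b′ :+ :- ⟨ 1 ⟩ :* (:- b :- :- b′)) refl (B j i) (B i j))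

      L-block : IsHelmBlock A B L
      L-block = record
        { rim-rim = λ i j → refl
        ; rim-pen = λ i j → refl
        ; pen-rim = λ i j → L-symm (rimIx j) (penIx i)
        ; pen-pen = T≈I
        }

      private
        open Projection A-symm B-symm L-block L-lap X≈X°

        P-proj : IsBlockProjection B P
        P-proj = record
          { hub-hub = DX′.hub-hub
          ; hub-rim = DX′.hub-rim
          ; hub-pen = DX′.hub-pen
          ; rim-hub = DX′.rim-hub
          ; rim-rim = λ i j → trans (P-rim-rim i j) (-‿cong (B-symm i j))
          ; rim-pen = P-rim-pen
          ; pen-hub = DX′.pen-hub
          ; pen-rim = P-pen-rim
          ; pen-pen = P-pen-pen
          }

        PX≈X : ∀ i j → (P *ᴹ X) i j ≈ X i j
        PX≈X i j = trans (*ⱽ-congʳ (λ k → X k j) (λ i k → sym (XD≈DX i k)) i) (MP.XMX≈X i j)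

      Ae : (A *ⱽ 𝐞) ≈ⱽ (fromℚ ((+ 3) / 2) •ⱽ 𝐞)
      Ae i = trans (sum-cong-≋ λ k → trans (*-identityʳ _) (A-symm k i))
        (trans (IsHelmLaplacian.rim-rim L-lap i) (sym (*-identityʳ _)))

      Be : (B *ⱽ 𝐞) ≈ⱽ (- 1# •ⱽ 𝐞)
      Be i = trans (sum-cong-≋ λ k → trans (*-identityʳ _) (B-symm k i))
        (trans (IsHelmLaplacian.rim-pen L-lap i) (sym (*-identityʳ _)))

      BS : (B *ᴹ S) ≈ᴹ (- 1# •ᴹ S)
      BS i j = modulo (trans (*-congˡ (sym (t-pen j i))) (½t-pen j i))
        (solve 2 (λ u s → u := :- ⟨ 1 ⟩ :* s :+ ⟨ 2 ⟩ :* (con ½ :* (u :+ s) :- ⟨ 0 ⟩))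
          refl ((B *ᴹ S) i j) (S i j))

      private
        -- The rim rows of `P X = X`: the rank-one terms on both sides agree, leaving `½ B L = -½ L`
        -- for the rim part of each column.
        B-L : ∀ i j → (B *ⱽ (λ k → L (rimIx k) j)) i ≈ - L (rimIx i) j
        B-L i j = modulo (trans (sym (B-X Be i j)) (trans (sym (BlockProjection.P-rim P-proj (λ k → X k j) i))
            (trans (PX≈X (rimIx i) j) (X-rim i j))))
          (solve 3 (λ u l c → u := :- l :+ ⟨ 2 ⟩ :* (con ½ :* u :+ c :- (con -½ :* l :+ c)))
            refl ((B *ⱽ (λ k → L (rimIx k) j)) i) (L (rimIx i) j) (α° * (fromℚ (ℚ.- ¼) * w° j)))

        B+I-L : ∀ i j → ((B +ᴹ I) *ⱽ (λ k → L (rimIx k) j)) i ≈ 0#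
        B+I-L i j = trans (B+I-*ⱽ B (λ k → L (rimIx k) j) i)
          (modulo (B-L i j) (solve 2 (λ u l → u :+ l := ⟨ 0 ⟩ :+ ⟨ 1 ⟩ :* (u :- :- l))
            refl ((B *ⱽ (λ k → L (rimIx k) j)) i) (L (rimIx i) j)))

      BA : ((B +ᴹ I) *ᴹ A) ≈ᴹ O
      BA i j = B+I-L i (rimIx j)

      BB : ((B +ᴹ I) *ᴹ B) ≈ᴹ O
      BB i j = B+I-L i (penIx j)

      ABS : (((A +ᴹ B) *ᴹ S) +ᴹ (fromℕ 2 •ᴹ B)) ≈ᴹ O
      ABS i j = modulo (trans (+-cong (*-congˡ (sym (t-rim j i))) (L-symm (penIx j) (rimIx i))) (½t-rim j i))
        (solve 2 (λ u b → u :+ ⟨ 2 ⟩ :* b := ⟨ 0 ⟩ :+ ⟨ 2 ⟩ :* (con ½ :* u :+ b :- ⟨ 0 ⟩))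
          refl (((A +ᴹ B) *ᴹ S) i j) (B i j))

    -- Passage between `blocks` and entrywise descriptions of `L`.

    helmBlocks : Matrix N N → Matrix N N → Matrix (suc (N ℕ.+ N)) (suc (N ℕ.+ N))
    helmBlocks A B = blocks
      (fromℚ ((+ N) / 2)) (fromℚ -½ •ⱽ 𝐞) 𝟎
      (fromℚ -½ •ⱽ 𝐞)     A               B
      𝟎                   (transpose B)   I

    private
      N/2 : fromℚ ((+ N) / 2) ≈ fromℚ ½ * ν
      N/2 = trans (reflexive (≡.cong fromℚ (/2 N))) (fromℚ-* ½ ((+ N) / 1))

    module _ (A B : Matrix N N) where

      private
        helmBlocks-rim : ∀ i → helmBlocks A B (rimIx i) ≡ col (fromℚ -½ * 1#) (A i) (B i)
        helmBlocks-rim = lookup-++ˡ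
          (λ i → col (fromℚ -½ * 1#) (A i) (B i)) (λ i → col 0# (transpose B i) (I i))

        helmBlocks-pen : ∀ i → helmBlocks A B (penIx i) ≡ col 0# (transpose B i) (I i)
        helmBlocks-pen = lookup-++ʳ
          (λ i → col (fromℚ -½ * 1#) (A i) (B i)) (λ i → col 0# (transpose B i) (I i))

      ≈helmBlocks : ∀ {L} → IsHelmLaplacian L → IsHelmBlock A B L → L ≈ᴹ helmBlocks A B
      ≈helmBlocks {L} L-lap L-block = index-elim (λ i → ∀ j → L i j ≈ helmBlocks A B i j)
        (col-≈ (trans L.hub-hub (sym N/2)) (λ j → trans (L.hub-rim j) (sym (*-identityʳ _))) L.hub-pen)
        (λ i j → trans
          (col-≈ {v = L (rimIx i)} (trans (L.rim-hub i) (sym (*-identityʳ _))) (L.rim-rim i) (L.rim-pen i) j)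
          (reflexive (≡.cong (λ r → r j) (≡.sym (helmBlocks-rim i)))))
        (λ i j → trans
          (col-≈ {v = L (penIx i)} (L.pen-hub i) (L.pen-rim i) (L.pen-pen i) j)
          (reflexive (≡.cong (λ r → r j) (≡.sym (helmBlocks-pen i)))))
        where
        module L where
          open IsHelmBlock L-block public
          open IsHelmLaplacian L-lap public using (hub-hub; hub-rim; hub-pen; rim-hub; pen-hub)

      module FromBlocks {L} (L≈ : L ≈ᴹ helmBlocks A B) where

        private
          rim-row : ∀ i j → L (rimIx i) j ≈ col (fromℚ -½ * 1#) (A i) (B i) j
          rim-row i j = trans (L≈ (rimIx i) j) (reflexive (≡.cong (λ r → r j) (helmBlocks-rim i)))

          pen-row : ∀ i j → L (penIx i) j ≈ col 0# (transpose B i) (I i) j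
          pen-row i j = trans (L≈ (penIx i) j) (reflexive (≡.cong (λ r → r j) (helmBlocks-pen i)))

        L-block : IsHelmBlock A B L
        L-block = record
          { rim-rim = λ i j → trans (rim-row i (rimIx j)) (reflexive (col-rim (fromℚ -½ * 1#) (A i) (B i) j))
          ; rim-pen = λ i j → trans (rim-row i (penIx j))
              (reflexive (col-pendant (fromℚ -½ * 1#) (A i) (B i) j))
          ; pen-rim = λ i j → trans (pen-row i (rimIx j)) (reflexive (col-rim 0# (transpose B i) (I i) j))
          ; pen-pen = λ i j → trans (pen-row i (penIx j)) (reflexive (col-pendant 0# (transpose B i) (I i) j))
          }

        L-lap : Symmetric A → Symmetric B → (A *ⱽ 𝐞) ≈ⱽ (fromℚ ((+ 3) / 2) •ⱽ 𝐞) →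
          (B *ⱽ 𝐞) ≈ⱽ (- 1# •ⱽ 𝐞) → IsHelmLaplacian L
        L-lap A-symm B-symm Ae Be = record
          { hub-hub = trans (L≈ zero zero) N/2
          ; hub-rim = λ j → trans (L≈ zero (rimIx j))
              (trans (reflexive (col-rim (fromℚ ((+ N) / 2)) (fromℚ -½ •ⱽ 𝐞) 𝟎 j)) (*-identityʳ _))
          ; hub-pen = λ j → trans (L≈ zero (penIx j))
              (reflexive (col-pendant (fromℚ ((+ N) / 2)) (fromℚ -½ •ⱽ 𝐞) 𝟎 j))
          ; rim-hub = λ i → trans (rim-row i zero) (*-identityʳ _)
          ; pen-hub = λ i → pen-row i zero
          ; rim-rim = λ j → row-sum A Ae j λ k → trans (L.rim-rim k j) (A-symm j k)
          ; pen-rim = λ j → row-sum B Be j λ k → L.pen-rim k j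
          ; rim-pen = λ j → row-sum B Be j λ k → trans (L.rim-pen k j) (B-symm j k)
          ; pen-pen = λ j → trans (sum-cong-≋ λ k → trans (L.pen-pen k j) (I-symm j k)) (sum-I j)
          }
          where
          module L = IsHelmBlock L-block
          row-sum : ∀ M {c} → (M *ⱽ 𝐞) ≈ⱽ (c •ⱽ 𝐞) → ∀ i {v : Vector ℝ N} →
            (∀ k → v k ≈ M i k) → sum v ≈ c
          row-sum M Me i v≈ = trans (sum-cong-≋ λ k → trans (v≈ k) (sym (*-identityʳ _)))
            (trans (Me i) (*-identityʳ _))

-- Adjacency on the cycle and entries of the circulant.

CyclicallyAdjacent : ℕ → ℕ → ℕ → Set
CyclicallyAdjacent N i j =
  suc i ≡ j ⊎ suc j ≡ i ⊎ (i ≡ 0 × suc j ≡ N) ⊎ (j ≡ 0 × suc i ≡ N)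

cyclicallyAdjacent? : ∀ N i j → Dec (CyclicallyAdjacent N i j)
cyclicallyAdjacent? N i j = suc i ℕ.≟ j ⊎-dec suc j ℕ.≟ i
  ⊎-dec (i ℕ.≟ 0 ×-dec suc j ℕ.≟ N) ⊎-dec (j ℕ.≟ 0 ×-dec suc i ℕ.≟ N)

CyclicallyAdjacent-sym : ∀ {N i j} → CyclicallyAdjacent N i j → CyclicallyAdjacent N j i
CyclicallyAdjacent-sym (inj₁ ij)               = inj₂ (inj₁ ij)
CyclicallyAdjacent-sym (inj₂ (inj₁ ji))        = inj₁ ji
CyclicallyAdjacent-sym (inj₂ (inj₂ (inj₁ ij))) = inj₂ (inj₂ (inj₂ ij))
CyclicallyAdjacent-sym (inj₂ (inj₂ (inj₂ ji))) = inj₂ (inj₂ (inj₁ ji))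

-- Rows and columns are natural numbers because the row of `Circ` is an iteration count of
-- `rotateRight`, over which the induction runs.
record CirculantEntry (N i j : ℕ) (x : ℝ) : Set where
  field
    diagonal : i ≡ j → x ≈ fromℕ 2
    adjacent : CyclicallyAdjacent N i j → x ≈ 1#
    distant  : i ≢ j → ¬ CyclicallyAdjacent N i j → x ≈ 0#

CirculantEntry-map : ∀ {N i j i′ j′ x} → (i′ ≡ j′ → i ≡ j) → (i ≡ j → i′ ≡ j′) →
  (CyclicallyAdjacent N i′ j′ → CyclicallyAdjacent N i j) →
  (CyclicallyAdjacent N i j → CyclicallyAdjacent N i′ j′) →
  CirculantEntry N i j x → CirculantEntry N i′ j′ x
CirculantEntry-map f g f′ g′ e = record
  { diagonal = λ eq → e.diagonal (f eq)
  ; adjacent = λ adj → e.adjacent (f′ adj)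
  ; distant  = λ neq ¬adj → e.distant (neq ∘ g) (¬adj ∘ g′)
  }
  where module e = CirculantEntry e

if-∨-yes : ∀ {A B : Set} (a : Dec A) (b : Dec B) → A ⊎ B →
  (if does a ∨ does b then 1# else 0#) ≈ 1#
if-∨-yes (yes _) b       _        = refl
if-∨-yes (no _)  (yes _) _        = refl
if-∨-yes (no ¬a) (no _)  (inj₁ a) = contradiction a ¬a
if-∨-yes (no _)  (no ¬b) (inj₂ b) = contradiction b ¬b

if-∨-no : ∀ {A B : Set} (a : Dec A) (b : Dec B) → ¬ A → ¬ B →
  (if does a ∨ does b then 1# else 0#) ≈ 0#
if-∨-no (yes a) b       ¬a ¬b = contradiction a ¬a
if-∨-no (no _)  (yes b) ¬a ¬b = contradiction b ¬b
if-∨-no (no _)  (no _)  ¬a ¬b = refl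

I-diagonal : ∀ (i : Fin n) → I i i ≈ 1#
I-diagonal i = reflexive (≡.cong (if_then 1# else 0#) (dec-true (i Fin.≟ i) ≡.refl))

I-off-diagonal : ∀ {i j : Fin n} → i ≢ j → I i j ≈ 0#
I-off-diagonal {i = i} {j} i≢j = reflexive (≡.cong (if_then 1# else 0#) (dec-false (i Fin.≟ j) i≢j))

-- Distances in the helm graph

module HelmDistance (N : ℕ) where

  private
    variable
      i j : Fin N
      u v : HelmVertex N
      ℓ : ℕ

  -- One case distinction shared by the distances, the walks realising them and the entries of `S`.
  data Position (i j : Fin N) : Set where
    same : i ≡ j → Position i j
    next : i ≢ j → CyclicallyAdjacent N (toℕ i) (toℕ j) → Position i j
    far  : i ≢ j → ¬ CyclicallyAdjacent N (toℕ i) (toℕ j) → Position i j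

  position : ∀ i j → Position i j
  position i j with i Fin.≟ j | cyclicallyAdjacent? N (toℕ i) (toℕ j)
  ... | yes i≡j | _      = same i≡j
  ... | no i≢j  | yes ij = next i≢j ij
  ... | no i≢j  | no ¬ij = far i≢j ¬ij

  rimGap pendantGap : Position i j → ℕ
  rimGap (same _)   = 0
  rimGap (next _ _) = 1
  rimGap (far _ _)  = 2
  pendantGap (same _)   = 0
  pendantGap (next _ _) = 3
  pendantGap (far _ _)  = 4

  distance : HelmVertex N → HelmVertex N → ℕ
  distance hub         hub         = 0
  distance hub         (rim j)     = 1
  distance hub         (pendant j) = 2
  distance (rim i)     hub         = 1
  distance (rim i)     (rim j)     = rimGap (position i j)
  distance (rim i)     (pendant j) = suc (rimGap (position i j))
  distance (pendant i) hub         = 2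
  distance (pendant i) (rim j)     = suc (rimGap (position i j))
  distance (pendant i) (pendant j) = pendantGap (position i j)

  rimGap≤2 : (p : Position i j) → rimGap p ℕ.≤ 2
  rimGap≤2 (same _)   = z≤n
  rimGap≤2 (next _ _) = s≤s z≤n
  rimGap≤2 (far _ _)  = ℕ.≤-refl

  rimGap-self : (p : Position i i) → rimGap p ≡ 0
  rimGap-self (same _)     = ≡.refl
  rimGap-self (next i≢i _) = contradiction ≡.refl i≢i
  rimGap-self (far i≢i _)  = contradiction ≡.refl i≢i

  pendantGap-self : (p : Position i i) → pendantGap p ≡ 0
  pendantGap-self (same _)     = ≡.refl
  pendantGap-self (next i≢i _) = contradiction ≡.refl i≢i
  pendantGap-self (far i≢i _)  = contradiction ≡.refl i≢i

  distance-self : ∀ v → distance v v ≡ 0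
  distance-self hub         = ≡.refl
  distance-self (rim i)     = rimGap-self (position i i)
  distance-self (pendant i) = pendantGap-self (position i i)

  rimGap-lipschitz : ∀ {i i′ j} → CyclicallyAdjacent N (toℕ i) (toℕ i′) →
    (p : Position i j) (q : Position i′ j) → rimGap p ℕ.≤ suc (rimGap q)
  rimGap-lipschitz ii′ (same _)   q          = z≤n
  rimGap-lipschitz ii′ (next _ _) q          = s≤s z≤n
  rimGap-lipschitz ii′ (far _ ¬ij) (same ≡.refl) = contradiction ii′ ¬ij
  rimGap-lipschitz ii′ (far _ _)  (next _ _) = ℕ.≤-refl
  rimGap-lipschitz ii′ (far _ _)  (far _ _)  = s≤s (s≤s z≤n)

  rim-lipschitz : CyclicallyAdjacent N (toℕ i) (toℕ j) → ∀ w →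
    distance (rim i) w ℕ.≤ suc (distance (rim j) w)
  rim-lipschitz         ij hub         = s≤s z≤n
  rim-lipschitz {i} {j} ij (rim k)     = rimGap-lipschitz ij (position i k) (position j k)
  rim-lipschitz {i} {j} ij (pendant k) = s≤s (rimGap-lipschitz ij (position i k) (position j k))

  -- The lower bound on walks: the candidate distance to `w` drops by at most 1 along an edge and is
  -- 0 at `w`, so no walk to `w` is shorter than it.
  distance-lipschitz : HelmAdjacent N u v → ∀ w → distance u w ℕ.≤ suc (distance v w)
  distance-lipschitz (fwd (spoke i)) hub         = z≤n
  distance-lipschitz (fwd (spoke i)) (rim j)     = s≤s z≤n
  distance-lipschitz (fwd (spoke i)) (pendant j) = s≤s (s≤s z≤n)
  distance-lipschitz (bwd (spoke i)) hub         = ℕ.≤-refl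
  distance-lipschitz (bwd (spoke i)) (rim j)     = rimGap≤2 (position i j)
  distance-lipschitz (bwd (spoke i)) (pendant j) = s≤s (rimGap≤2 (position i j))
  distance-lipschitz (fwd (leaf i)) hub         = s≤s z≤n
  distance-lipschitz (fwd (leaf i)) (rim j)     = ℕ.m≤n+m (rimGap (position i j)) 2
  distance-lipschitz (fwd (leaf i)) (pendant j) = bound (position i j)
    where
    bound : (p : Position i j) → suc (rimGap p) ℕ.≤ suc (pendantGap p)
    bound (same _)   = ℕ.≤-refl
    bound (next _ _) = s≤s (s≤s z≤n)
    bound (far _ _)  = s≤s (s≤s (s≤s z≤n))
  distance-lipschitz (bwd (leaf i)) hub         = ℕ.≤-refl
  distance-lipschitz (bwd (leaf i)) (rim j)     = ℕ.≤-refl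
  distance-lipschitz (bwd (leaf i)) (pendant j) = bound (position i j)
    where
    bound : (p : Position i j) → pendantGap p ℕ.≤ suc (suc (rimGap p))
    bound (same _)   = z≤n
    bound (next _ _) = ℕ.≤-refl
    bound (far _ _)  = ℕ.≤-refl
  distance-lipschitz (fwd (step i j eq)) = rim-lipschitz (inj₁ eq)
  distance-lipschitz (bwd (step i j eq)) = rim-lipschitz (inj₂ (inj₁ eq))
  distance-lipschitz (fwd (close i j p q)) = rim-lipschitz (inj₂ (inj₂ (inj₂ (q , p))))
  distance-lipschitz (bwd (close i j p q)) = rim-lipschitz (inj₂ (inj₂ (inj₁ (q , p))))

  distance≤length : ∀ {w} → Walk (HelmAdjacent N) ℓ u w → distance u w ℕ.≤ ℓ
  distance≤length {u = u} nil = ℕ.≤-reflexive (distance-self u)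
  distance≤length {w = w} (cons uv walk) =
    ℕ.≤-trans (distance-lipschitz uv w) (s≤s (distance≤length walk))

  rim-adjacent : CyclicallyAdjacent N (toℕ i) (toℕ j) → HelmAdjacent N (rim i) (rim j)
  rim-adjacent (inj₁ eq)                     = fwd (step _ _ eq)
  rim-adjacent (inj₂ (inj₁ eq))              = bwd (step _ _ eq)
  rim-adjacent (inj₂ (inj₂ (inj₁ (eq , p)))) = bwd (close _ _ p eq)
  rim-adjacent (inj₂ (inj₂ (inj₂ (eq , p)))) = fwd (close _ _ p eq)

  snoc : ∀ {w} → Walk (HelmAdjacent N) ℓ u v → HelmAdjacent N v w → Walk (HelmAdjacent N) (suc ℓ) u w
  snoc nil            vw = cons vw nil
  snoc (cons uu′ walk) vw = cons uu′ (snoc walk vw)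

  rim-walk : (p : Position i j) → Walk (HelmAdjacent N) (rimGap p) (rim i) (rim j)
  rim-walk (same ≡.refl) = nil
  rim-walk (next _ ij)   = cons (rim-adjacent ij) nil
  rim-walk (far _ _)     = cons (bwd (spoke _)) (cons (fwd (spoke _)) nil)

  pendant-walk : (p : Position i j) → Walk (HelmAdjacent N) (pendantGap p) (pendant i) (pendant j)
  pendant-walk (same ≡.refl)   = nil
  pendant-walk p@(next _ _)    = cons (bwd (leaf _)) (snoc (rim-walk p) (fwd (leaf _)))
  pendant-walk p@(far _ _)     = cons (bwd (leaf _)) (snoc (rim-walk p) (fwd (leaf _)))

  walk : ∀ u v → Walk (HelmAdjacent N) (distance u v) u v
  walk hub         hub         = nil
  walk hub         (rim j)     = cons (fwd (spoke j)) nil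
  walk hub         (pendant j) = cons (fwd (spoke j)) (cons (fwd (leaf j)) nil)
  walk (rim i)     hub         = cons (bwd (spoke i)) nil
  walk (rim i)     (rim j)     = rim-walk (position i j)
  walk (rim i)     (pendant j) = snoc (rim-walk (position i j)) (fwd (leaf j))
  walk (pendant i) hub         = cons (bwd (leaf i)) (cons (bwd (spoke i)) nil)
  walk (pendant i) (rim j)     = cons (bwd (leaf i)) (rim-walk (position i j))
  walk (pendant i) (pendant j) = pendant-walk (position i j)

  distance-unique : ∀ {d} → IsDistance (HelmAdjacent N) u v d → d ≡ distance u v
  distance-unique {u} {v} (shortest , minimal) =
    ℕ.≤-antisym (minimal (distance u v) (walk u v)) (distance≤length shortest)

-- The circulant matrix S

module HelmCirculant (K : ℕ) where

  private
    N : ℕ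
    N = suc (suc (suc K))
    S : Matrix N N
    S = Circ (𝐬 N)

  open HelmDistance N
  open HelmAlgebra S using (IsHelmForm; rimIx; penIx)

  𝐬-entry : ∀ j → CirculantEntry N 0 (toℕ j) (𝐬 N j)
  𝐬-entry zero = record
    { diagonal = λ _ → refl
    ; adjacent = λ where
        (inj₂ (inj₂ (inj₁ (_ , ()))))
        (inj₂ (inj₂ (inj₂ (_ , ()))))
    ; distant  = λ 0≢0 _ → contradiction ≡.refl 0≢0
    }
  𝐬-entry (suc j) = record
    { diagonal = λ ()
    ; adjacent = λ where
        (inj₁ eq)                      → if-∨-yes j≟0 j≟last (inj₁ (≡.sym eq))
        (inj₂ (inj₂ (inj₁ (_ , last)))) → if-∨-yes j≟0 j≟last (inj₂ last)
    ; distant  = λ _ ¬adj → if-∨-no j≟0 j≟last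
        (λ eq → ¬adj (inj₁ (≡.sym eq))) (λ last → ¬adj (inj₂ (inj₂ (inj₁ (≡.refl , last)))))
    }
    where
    j≟0 = suc (toℕ j) ℕ.≟ 1
    j≟last = suc (suc (toℕ j)) ℕ.≟ N

  -- Diagonal and cyclic adjacency are invariant under shifting both indices by 1 modulo `N`. The
  -- bound on `m` keeps the row from wrapping; the column wraps at entry 0, which comes from column
  -- `N - 1`.
  rotate-entry : ∀ {m} {v : Vector ℝ N} → suc m ℕ.< N → (∀ j → CirculantEntry N m (toℕ j) (v j)) →
    ∀ j → CirculantEntry N (suc m) (toℕ j) (rotateRight v j)
  rotate-entry {m} {v} m<N h zero = CirculantEntry-map
    (λ ()) (λ m≡last → contradiction (≡.cong suc (≡.trans m≡last toℕ-last)) (ℕ.<⇒≢ m<N))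
    (λ where
      (inj₂ (inj₁ 1≡m)) → inj₂ (inj₂ (inj₁ (≡.sym (ℕ.suc-injective 1≡m) , ≡.cong suc toℕ-last)))
      (inj₂ (inj₂ (inj₂ (_ , last)))) → inj₁ (≡.trans (ℕ.suc-injective last) (≡.sym toℕ-last)))
    (λ where
      (inj₁ eq) → inj₂ (inj₂ (inj₂ (≡.refl , ≡.cong suc (≡.trans eq toℕ-last))))
      (inj₂ (inj₁ eq)) → contradiction (≡.trans (≡.sym eq) (≡.cong suc toℕ-last))
          (ℕ.<⇒≢ (ℕ.<-trans (ℕ.n<1+n m) m<N))
      (inj₂ (inj₂ (inj₁ (m≡0 , _)))) → inj₂ (inj₁ (≡.cong suc (≡.sym m≡0)))
      (inj₂ (inj₂ (inj₂ (_ , last)))) → contradiction last (ℕ.<⇒≢ m<N))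
    (h (Fin.fromℕ (suc (suc K))))
    where
    toℕ-last : toℕ (Fin.fromℕ (suc (suc K))) ≡ suc (suc K)
    toℕ-last = Fin.toℕ-fromℕ (suc (suc K))
  rotate-entry {m} {v} m<N h (suc j) = CirculantEntry-map
    (λ eq → ≡.trans (ℕ.suc-injective eq) (≡.sym (Fin.toℕ-inject₁ j)))
    (λ eq → ≡.cong suc (≡.trans eq (Fin.toℕ-inject₁ j)))
    (λ where
      (inj₁ eq) → inj₁ (≡.trans (ℕ.suc-injective eq) (≡.sym (Fin.toℕ-inject₁ j)))
      (inj₂ (inj₁ eq)) → inj₂ (inj₁ (≡.trans (≡.cong suc (Fin.toℕ-inject₁ j)) (ℕ.suc-injective eq)))
      (inj₂ (inj₂ (inj₁ (() , _))))
      (inj₂ (inj₂ (inj₂ (() , _)))))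
    (λ where
      (inj₁ eq) → inj₁ (≡.cong suc (≡.trans eq (Fin.toℕ-inject₁ j)))
      (inj₂ (inj₁ eq)) → inj₂ (inj₁ (≡.cong suc (≡.trans (≡.cong suc (≡.sym (Fin.toℕ-inject₁ j))) eq)))
      (inj₂ (inj₂ (inj₁ (_ , last)))) →
        contradiction (≡.trans (≡.sym (≡.cong suc (Fin.toℕ-inject₁ j))) last) (ℕ.<⇒≢ (s≤s (Fin.toℕ<n j)))
      (inj₂ (inj₂ (inj₂ (_ , last)))) → contradiction last (ℕ.<⇒≢ m<N))
    (h (inject₁ j))

  fold-entry : ∀ m → m ℕ.< N → ∀ j → CirculantEntry N m (toℕ j) (fold (𝐬 N) rotateRight m j)
  fold-entry zero    _   = 𝐬-entry
  fold-entry (suc m) m<N = rotate-entry m<N (fold-entry m (ℕ.<-trans (ℕ.n<1+n m) m<N))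

  private
    S-entry : ∀ i j → CirculantEntry N (toℕ i) (toℕ j) (S i j)
    S-entry i = fold-entry (toℕ i) (Fin.toℕ<n i)

  -- An entry of `S` falls short of 2 by the distance on the rim, which is why `2 J - S` is the rim
  -- block.
  S≈ : ∀ {i j} (p : Position i j) → S i j ≈ fromℕ (2 ℕ.∸ rimGap p)
  S≈ {i} (same ≡.refl)  = CirculantEntry.diagonal (S-entry i i) ≡.refl
  S≈ {i} {j} (next _ ij)   = CirculantEntry.adjacent (S-entry i j) ij
  S≈ {i} {j} (far i≢j ¬ij) = CirculantEntry.distant (S-entry i j) (i≢j ∘ Fin.toℕ-injective) ¬ij

  S-symm : Symmetric S
  S-symm i j with position i j
  ... | same ≡.refl    = refl
  ... | p@(next i≢j ij) = trans (S≈ (next (i≢j ∘ ≡.sym) (CyclicallyAdjacent-sym ij))) (sym (S≈ p))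
  ... | p@(far i≢j ¬ij) = trans (S≈ (far (i≢j ∘ ≡.sym) (¬ij ∘ CyclicallyAdjacent-sym))) (sym (S≈ p))

  -- As `N` is at least 3, the two entries 1 stand at different positions: after the leading `2, 1`
  -- there remains a unit vector supported at the last position.
  sum-𝐬 : sum (𝐬 N) ≈ fromℕ 4
  sum-𝐬 = trans (+-congˡ (+-congˡ (trans (sum-cong-≋ tail≈) (sum-I (Fin.fromℕ K)))))
    (solve 0 (⟨ 2 ⟩ :+ (⟨ 1 ⟩ :+ ⟨ 1 ⟩) := ⟨ 4 ⟩) refl)
    where
    tail≈ : ∀ k → 𝐬 N (suc (suc k)) ≈ I (Fin.fromℕ K) k
    tail≈ k with Fin.fromℕ K Fin.≟ k
    ... | yes ≡.refl = CirculantEntry.adjacent (𝐬-entry (suc (suc k)))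
      (inj₂ (inj₂ (inj₁ (≡.refl , ≡.cong (3 ℕ.+_) (Fin.toℕ-fromℕ K)))))
    ... | no last≢k = CirculantEntry.distant (𝐬-entry (suc (suc k))) (λ ()) λ where
      (inj₂ (inj₂ (inj₁ (_ , eq)))) → last≢k (Fin.toℕ-injective (≡.trans (Fin.toℕ-fromℕ K)
        (≡.sym (ℕ.suc-injective (ℕ.suc-injective (ℕ.suc-injective eq))))))

  S-sum : ∀ i → sum (S i) ≈ fromℕ 4
  S-sum i = trans (sum-fold (toℕ i)) sum-𝐬
    where
    sum-rotateRight : (v : Vector ℝ N) → sum (rotateRight v) ≈ sum v
    sum-rotateRight v = trans (+-comm (last v) (sum (init v))) (sym (sum-init-last v))
    sum-fold : ∀ m → sum (fold (𝐬 N) rotateRight m) ≈ sum (𝐬 N)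
    sum-fold zero    = refl
    sum-fold (suc m) = trans (sum-rotateRight (fold (𝐬 N) rotateRight m)) (sum-fold m)

  helm-form : ∀ {D} → IsHelmDistanceMatrix (suc N) D → IsHelmForm D
  helm-form {D} dist = record
    { hub-hub = entry ≡.refl ≡.refl
    ; hub-rim = λ j → entry ≡.refl (rim-vertex j)
    ; hub-pen = λ j → entry ≡.refl (pen-vertex j)
    ; rim-hub = λ i → entry (rim-vertex i) ≡.refl
    ; rim-rim = λ i j → trans (entry (rim-vertex i) (rim-vertex j)) (rim-rim (position i j))
    ; rim-pen = λ i j → trans (entry (rim-vertex i) (pen-vertex j)) (rim-pen (position i j))
    ; pen-hub = λ i → entry (pen-vertex i) ≡.refl
    ; pen-rim = λ i j → trans (entry (pen-vertex i) (rim-vertex j)) (rim-pen (position i j))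
    ; pen-pen = λ i j → trans (entry (pen-vertex i) (pen-vertex j)) (pen-pen (position i j))
    }
    where
    entry : ∀ {i j u v} → helmVertices (suc N) i ≡ u → helmVertices (suc N) j ≡ v →
      D i j ≈ fromℕ (distance u v)
    entry {i} {j} ≡.refl ≡.refl with d , d-dist , D≈d ← dist i j =
      trans D≈d (reflexive (≡.cong fromℕ (distance-unique d-dist)))

    rim-vertex : ∀ i → helmVertices (suc N) (rimIx i) ≡ rim i
    rim-vertex = lookup-++ˡ rim pendant

    pen-vertex : ∀ i → helmVertices (suc N) (penIx i) ≡ pendant i
    pen-vertex = lookup-++ʳ rim pendant

    rim-rim : ∀ {i j} (p : Position i j) → fromℕ (rimGap p) ≈ fromℕ 2 + - S i j
    rim-rim p = trans (gap p) (+-congˡ (-‿cong (sym (S≈ p))))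
      where
      gap : ∀ {i j} (p : Position i j) → fromℕ (rimGap p) ≈ fromℕ 2 + - fromℕ (2 ℕ.∸ rimGap p)
      gap (same _)   = solve 0 (⟨ 0 ⟩ := ⟨ 2 ⟩ :+ :- ⟨ 2 ⟩) refl
      gap (next _ _) = solve 0 (⟨ 1 ⟩ := ⟨ 2 ⟩ :+ :- ⟨ 1 ⟩) refl
      gap (far _ _)  = solve 0 (⟨ 2 ⟩ := ⟨ 2 ⟩ :+ :- ⟨ 0 ⟩) refl

    rim-pen : ∀ {i j} (p : Position i j) → fromℕ (suc (rimGap p)) ≈ fromℕ 3 + - S i j
    rim-pen {i} {j} p = trans (fromℕ-suc (rimGap p)) (trans (+-congˡ (rim-rim p))
      (solve 1 (λ s → ⟨ 1 ⟩ :+ (⟨ 2 ⟩ :+ :- s) := ⟨ 3 ⟩ :+ :- s) refl (S i j)))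

    pen-pen : ∀ {i j} (p : Position i j) →
      fromℕ (pendantGap p) ≈ fromℕ 4 + - (S i j + fromℕ 2 * I i j)
    pen-pen {i} p@(same ≡.refl) = trans (solve 0 (⟨ 0 ⟩ := ⟨ 4 ⟩ :+ :- (⟨ 2 ⟩ :+ ⟨ 2 ⟩ :* ⟨ 1 ⟩)) refl)
      (+-congˡ (-‿cong (sym (+-cong (S≈ p) (*-congˡ (I-diagonal i))))))
    pen-pen p@(next i≢j _) = trans (solve 0 (⟨ 3 ⟩ := ⟨ 4 ⟩ :+ :- (⟨ 1 ⟩ :+ ⟨ 2 ⟩ :* ⟨ 0 ⟩)) refl)
      (+-congˡ (-‿cong (sym (+-cong (S≈ p) (*-congˡ (I-off-diagonal i≢j))))))
    pen-pen p@(far i≢j _) = trans (solve 0 (⟨ 4 ⟩ := ⟨ 4 ⟩ :+ :- (⟨ 0 ⟩ :+ ⟨ 2 ⟩ :* ⟨ 0 ⟩)) refl)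
      (+-congˡ (-‿cong (sym (+-cong (S≈ p) (*-congˡ (I-off-diagonal i≢j))))))

theorem4p5 : (n : ℕ) → 4 ≤ n →
  (D : Matrix (helmOrder n) (helmOrder n)) → IsHelmDistanceMatrix n D →
  let S = Circ (𝐬 (n ∸ 1)) in
  (L : Matrix (helmOrder n) (helmOrder n)) →
  ( LaplacianLike L
  × Σ[ α ∈ ℝ ] Σ[ w ∈ Vector ℝ (helmOrder n) ]
      ( α ≉ 0#
      × sum w ≈ 1#
      × IsMoorePenroseInverse D ((fromℚ -½ •ᴹ L) +ᴹ (α •ᴹ outer w w))))
  ⇔
  ( Σ[ A ∈ Matrix (n ∸ 1) (n ∸ 1) ] Σ[ B ∈ Matrix (n ∸ 1) (n ∸ 1) ]
      ( Symmetric A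
      × Symmetric B
      × L ≈ᴹ blocks
          (fromℚ ((+ (n ∸ 1)) / 2)) (fromℚ -½ •ⱽ 𝐞) 𝟎
          (fromℚ -½ •ⱽ 𝐞)           A               B
          𝟎                         (transpose B)   I
      × (A *ⱽ 𝐞) ≈ⱽ (fromℚ ((+ 3) / 2) •ⱽ 𝐞)
      × (B *ⱽ 𝐞) ≈ⱽ ((- 1#) •ⱽ 𝐞)
      × (B *ᴹ S) ≈ᴹ ((- 1#) •ᴹ S)
      × ((B +ᴹ I) *ᴹ A) ≈ᴹ O
      × ((B +ᴹ I) *ᴹ B) ≈ᴹ O
      × (((A +ᴹ B) *ᴹ S) +ᴹ (fromℕ 2 •ᴹ B)) ≈ᴹ O))
theorem4p5 (suc (suc (suc (suc K)))) (s≤s (s≤s (s≤s (s≤s z≤n)))) D D-dist L = mk⇔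
  (λ { ((L-symm , L-row) , α , w , _ , w-sum , mp) →
    let open Necessity L-symm L-row w-sum mp in
    A , B , A-symm , B-symm , ≈helmBlocks A B L-lap L-block , Ae , Be , BS , BA , BB , ABS })
  (λ { (A , B , A-symm , B-symm , L≈ , Ae , Be , BS , BA , BB , ABS) →
    let open FromBlocks A B L≈
        lap = L-lap A-symm B-symm Ae Be
        open Sufficiency A-symm B-symm L-block lap Be BS BA BB ABS
    in IsHelmLaplacian⇒LaplacianLike L-symm lap , α° , w° , α°≉0 , sum-w° , X°-isMoorePenroseInverse })
  where
  N = suc (suc (suc K))
  open HelmCirculant K
  open HelmAlgebra (Circ (𝐬 N))
  open Helm S-symm S-sum (fromℚ ((+ 1) / N))
    (trans (sym (fromℚ-* ((+ N) / 1) ((+ 1) / N))) (reflexive (≡.cong fromℚ (1/suc (suc (suc K))))))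
    D (helm-form D-dist)
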